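{- If $G$ is a graph with minimum degree $\delta$ and maximum degree $\Delta$, and $\alpha>0$, then $$2\delta^{2\alpha}M_2^{ -\alpha}(G)\le SDD_{\alpha}(G)\le 2\Delta^{2\alpha}M_2^{ -\alpha}(G),$$ $$\Delta^{ -2\alpha}M_1^{2\alpha+1}(G)\le SDD_{\alpha}(G)\le \delta^{ -2\alpha}M_1^{2\alpha+1}(G),$$ and the equality in each bound is attained if and only if $G$ is regular.
   Context: For a graph $G$ with vertex set $V(G)$ and edge set $E(G)$, $d_u$ denotes the degree of the vertex $u$, and $uv$ denotes the edge of $G$ connecting the vertices $u$ and $v$. For $\alpha\in\mathbb{R}$, the variable symmetric division deg index is $$SDD_\alpha(G)=\sum_{uv\in E(G)}\left(\frac{d_u^\alpha}{d_v^\alpha}+\frac{d_v^\alpha}{d_u^\alpha}\right).$$ For $a\in\mathbb{R}$, the first and second variable Zagreb indices (here the superscript $a$ on $M_1$ and $M_2$ is a parameter, not a power) are $$M_1^{a}(G)=\sum_{u\in V(G)}d_u^{a},\qquad M_2^{a}(G)=\sum_{uv\in E(G)}(d_ud_v)^{a}.$$ A graph is regular if all its vertices have the same degree.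
   Formalization: The graph is assumed to have no isolated vertices (δ > 0): for δ = 0 the term δ^{ -2α} is undefined, and for K₂ plus an isolated vertex equality holds in the upper bound 2Δ^{2α}M₂^{ -α}(G) although the graph is not regular. -}

module Defs where

open import Algebra.Bundles using (CommutativeRing)
open import Data.Bool.Base using (Bool; false; _∧_)
open import Data.Fin.Base as Fin using (Fin)
open import Data.Integer.Base as ℤ using (ℤ; +_; -[1+_])
import Data.Integer.Properties as ℤ
open import Data.List.Base using (List; length; filterᵇ; allFin; cartesianProduct; foldr)
open import Data.Nat.Base as ℕ using (ℕ; zero; suc; NonZero)
import Data.Nat.Properties as ℕ
open import Data.Product.Base using (∃-syntax; _×_; _,_; proj₁; proj₂)
open import Data.Rational.Base as ℚ using (ℚ; 0ℚ; 1ℚ; ½)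
import Data.Rational.Properties as ℚ
import Data.Rational.Unnormalised.Base as ℚᵘ
import Data.Rational.Unnormalised.Properties as ℚᵘ
open import Data.Sum.Base using (inj₁; inj₂)
open import Relation.Binary.PropositionalEquality using (_≡_; refl; sym; trans; cong; cong₂; subst; subst₂)
open import Relation.Nullary using (¬_; yes; no; contradiction)
open import Relation.Unary using (Decidable)

module RationalPower where

  open import Algebra.Properties.CommutativeSemiring.Exp
    (CommutativeRing.commutativeSemiring ℚ.+-*-commutativeRing) public
    using (_^_; ^-homo-*; ^-assocʳ; ^-distrib-*)

  open import Data.Rational.Base using (_+_; _*_; -_; _-_; _/_; _≤_; _<_; ∣_∣; nonNegative; positive)
  open import Data.Rational.Solver
  open +-*-Solver using (solve; _:+_; _:*_; :-_; _:=_; con)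

  0≤1 : 0ℚ ≤ 1ℚ
  0≤1 = ℚ.nonNegative⁻¹ 1ℚ

  0<1 : 0ℚ < 1ℚ
  0<1 = ℚ.positive⁻¹ 1ℚ

  0<½ : 0ℚ < ½
  0<½ = ℚ.positive⁻¹ ½

  *-monoˡ : ∀ {a b} c → 0ℚ ≤ c → a ≤ b → c * a ≤ c * b
  *-monoˡ c 0≤c = ℚ.*-monoˡ-≤-nonNeg c {{nonNegative 0≤c}}

  *-monoʳ : ∀ {a b} c → 0ℚ ≤ c → a ≤ b → a * c ≤ b * c
  *-monoʳ c 0≤c = ℚ.*-monoʳ-≤-nonNeg c {{nonNegative 0≤c}}

  *-mono : ∀ {a b c d} → 0ℚ ≤ a → 0ℚ ≤ d → a ≤ b → c ≤ d → a * c ≤ b * d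
  *-mono {a} {b} {c} {d} 0≤a 0≤d a≤b c≤d =
    ℚ.≤-trans (*-monoˡ a 0≤a c≤d) (*-monoʳ d 0≤d a≤b)

  0≤* : ∀ {a b} → 0ℚ ≤ a → 0ℚ ≤ b → 0ℚ ≤ a * b
  0≤* {a} {b} 0≤a 0≤b =
    ℚ.nonNegative⁻¹ _ {{ℚ.nonNeg*nonNeg⇒nonNeg a {{nonNegative 0≤a}} b {{nonNegative 0≤b}}}}

  0<* : ∀ {a b} → 0ℚ < a → 0ℚ < b → 0ℚ < a * b
  0<* {a} {b} 0<a 0<b =
    ℚ.positive⁻¹ _ {{ℚ.pos*pos⇒pos a {{positive 0<a}} b {{positive 0<b}}}}

  0≤+ : ∀ {a b} → 0ℚ ≤ a → 0ℚ ≤ b → 0ℚ ≤ a + b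
  0≤+ = ℚ.+-mono-≤

  half+half : ∀ ε → ½ * ε + ½ * ε ≡ ε
  half+half ε = trans (sym (ℚ.*-distribʳ-+ ε ½ ½)) (ℚ.*-identityˡ ε)

  ≤⇒-≤ : ∀ {a b c} → a ≤ b + c → a - b ≤ c
  ≤⇒-≤ {a} {b} {c} h = subst (a - b ≤_)
    (solve 2 (λ b c → (b :+ c) :+ (:- b) := c) refl b c) (ℚ.+-monoˡ-≤ (- b) h)

  -≤⇒≤ : ∀ {a b c} → a - b ≤ c → a ≤ b + c
  -≤⇒≤ {a} {b} {c} h = subst₂ _≤_
    (solve 2 (λ a b → b :+ (a :+ (:- b)) := a) refl a b) refl (ℚ.+-monoʳ-≤ b h)

  ∣-∣≤ : ∀ {a b c} → a ≤ b + c → b ≤ a + c → ∣ a - b ∣ ≤ c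
  ∣-∣≤ {a} {b} {c} h h′ with ℚ.∣p∣≡p∨∣p∣≡-p (a - b)
  ... | inj₁ e = subst (_≤ c) (sym e) (≤⇒-≤ h)
  ... | inj₂ e = subst (_≤ c)
    (trans (solve 2 (λ a b → b :+ (:- a) := :- (a :+ (:- b))) refl a b) (sym e)) (≤⇒-≤ h′)

  ≤∣∣ : ∀ a → a ≤ ∣ a ∣
  ≤∣∣ a with ℚ.≤-total 0ℚ a
  ... | inj₁ 0≤a = ℚ.≤-reflexive (sym (ℚ.0≤p⇒∣p∣≡p 0≤a))
  ... | inj₂ a≤0 = ℚ.≤-trans a≤0 (ℚ.0≤∣p∣ a)

  ∣-∣⇒≤ : ∀ {a b c} → ∣ a - b ∣ ≤ c → a ≤ b + c
  ∣-∣⇒≤ {a} {b} h = -≤⇒≤ (ℚ.≤-trans (≤∣∣ (a - b)) h)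

  ∣-∣-comm : ∀ a b → ∣ a - b ∣ ≡ ∣ b - a ∣
  ∣-∣-comm a b = trans (cong ∣_∣ (solve 2 (λ a b → a :+ (:- b) := :- (b :+ (:- a))) refl a b))
                       (ℚ.∣-p∣≡∣p∣ (b - a))

  infix 8 _/suc_

  -- Opaque, as are `recip` and `root`: the type checker must not compute the
  -- normal forms of symbolic fractions.
  opaque
    _/suc_ : ℕ → ℕ → ℚ
    a /suc n = + a / suc n

    /suc-toℚᵘ : ∀ a n → ℚ.toℚᵘ (a /suc n) ℚᵘ.≃ ℚᵘ.mkℚᵘ (+ a) n
    /suc-toℚᵘ a n = ℚ.toℚᵘ-fromℚᵘ (ℚᵘ.mkℚᵘ (+ a) n)

    1/suc0≡1 : 1 /suc 0 ≡ 1ℚ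
    1/suc0≡1 = refl

    0/suc≡0 : ∀ n → 0 /suc n ≡ 0ℚ
    0/suc≡0 n = ℚ.0/n≡0 (suc n)

    0≤/suc : ∀ a n → 0ℚ ≤ a /suc n
    0≤/suc a n = ℚ.nonNegative⁻¹ _ {{ℚ.normalize-nonNeg a (suc n)}}

    0</suc : ∀ a n → 0ℚ < suc a /suc n
    0</suc a n = ℚ.positive⁻¹ _ {{ℚ.normalize-pos (suc a) (suc n)}}

  private
    pos-*-≤ : ∀ {a b c d} → a ℕ.* b ℕ.≤ c ℕ.* d → + a ℤ.* + b ℤ.≤ + c ℤ.* + d
    pos-*-≤ {a} {b} {c} {d} h = subst₂ ℤ._≤_ (ℤ.pos-* a b) (ℤ.pos-* c d) (ℤ.+≤+ h)

    pos-*-< : ∀ {a b c d} → a ℕ.* b ℕ.< c ℕ.* d → + a ℤ.* + b ℤ.< + c ℤ.* + d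
    pos-*-< {a} {b} {c} {d} h = subst₂ ℤ._<_ (ℤ.pos-* a b) (ℤ.pos-* c d) (ℤ.+<+ h)

  /suc-mono-≤ : ∀ a m b n → a ℕ.* suc n ℕ.≤ b ℕ.* suc m → a /suc m ≤ b /suc n
  /suc-mono-≤ a m b n h = ℚ.toℚᵘ-cancel-≤
    (ℚᵘ.≤-respˡ-≃ (ℚᵘ.≃-sym (/suc-toℚᵘ a m)) (ℚᵘ.≤-respʳ-≃ (ℚᵘ.≃-sym (/suc-toℚᵘ b n))
      (ℚᵘ.*≤* (pos-*-≤ {a} {suc n} {b} {suc m} h))))

  /suc-mono-< : ∀ a m b n → a ℕ.* suc n ℕ.< b ℕ.* suc m → a /suc m < b /suc n
  /suc-mono-< a m b n h = ℚ.toℚᵘ-cancel-<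
    (ℚᵘ.<-respˡ-≃ (ℚᵘ.≃-sym (/suc-toℚᵘ a m)) (ℚᵘ.<-respʳ-≃ (ℚᵘ.≃-sym (/suc-toℚᵘ b n))
      (ℚᵘ.*<* (pos-*-< {a} {suc n} {b} {suc m} h))))

  /suc-+ : ∀ a b n → a /suc n + b /suc n ≡ (a ℕ.+ b) /suc n
  /suc-+ a b n = ℚ.toℚᵘ-injective (ℚᵘ.≃-trans (ℚ.toℚᵘ-homo-+ (a /suc n) (b /suc n))
    (ℚᵘ.≃-trans (ℚᵘ.+-cong (/suc-toℚᵘ a n) (/suc-toℚᵘ b n))
    (ℚᵘ.≃-trans (ℚᵘ.*≡* eq) (ℚᵘ.≃-sym (/suc-toℚᵘ (a ℕ.+ b) n)))))
    where
    s = + suc n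
    eq : (+ a ℤ.* s ℤ.+ + b ℤ.* s) ℤ.* s ≡ + (a ℕ.+ b) ℤ.* (s ℤ.* s)
    eq = trans (cong (ℤ._* s) (sym (ℤ.*-distribʳ-+ s (+ a) (+ b)))) (ℤ.*-assoc (+ (a ℕ.+ b)) s s)

  /suc-*-cancel : ∀ a n → a /suc n * suc n /suc 0 ≡ a /suc 0
  /suc-*-cancel a n = ℚ.toℚᵘ-injective (ℚᵘ.≃-trans (ℚ.toℚᵘ-homo-* (a /suc n) (suc n /suc 0))
    (ℚᵘ.≃-trans (ℚᵘ.*-cong (/suc-toℚᵘ a n) (/suc-toℚᵘ (suc n) 0))
    (ℚᵘ.≃-trans (ℚᵘ.*≡* eq) (ℚᵘ.≃-sym (/suc-toℚᵘ a 0)))))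
    where
    eq : (+ a ℤ.* + suc n) ℤ.* + 1 ≡ + a ℤ.* + (suc n ℕ.* 1)
    eq = trans (ℤ.*-identityʳ (+ a ℤ.* + suc n)) (cong (λ k → + a ℤ.* + k) (sym (ℕ.*-identityʳ (suc n))))

  fromℕ : ℕ → ℚ
  fromℕ n = n /suc 0

  fromℕ-suc : ∀ n → fromℕ (suc n) ≡ 1ℚ + fromℕ n
  fromℕ-suc n = trans (sym (/suc-+ 1 n 0)) (cong (_+ fromℕ n) 1/suc0≡1)

  fromℕ-mono : ∀ {m n} → m ℕ.≤ n → fromℕ m ≤ fromℕ n
  fromℕ-mono {m} {n} m≤n = /suc-mono-≤ m 0 n 0 (ℕ.*-monoˡ-≤ 1 m≤n)

  ≤-num : ∀ x → x ≤ fromℕ ℤ.∣ ℚ.↥ x ∣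
  ≤-num x@(ℚ.mkℚ p d c) = ℚ.toℚᵘ-cancel-≤ (ℚᵘ.≤-respʳ-≃ (ℚᵘ.≃-sym (/suc-toℚᵘ ℤ.∣ p ∣ 0)) (ℚᵘ.*≤* le))
    where
    i≤∣i∣ : ∀ i → i ℤ.≤ + ℤ.∣ i ∣
    i≤∣i∣ (+ n)    = ℤ.≤-refl
    i≤∣i∣ -[1+ n ] = ℤ.-≤+
    le : p ℤ.* + 1 ℤ.≤ + ℤ.∣ p ∣ ℤ.* + suc d
    le = ℤ.≤-trans (ℤ.≤-reflexive (ℤ.*-identityʳ p)) (ℤ.≤-trans (i≤∣i∣ p)
           (subst₂ ℤ._≤_ refl (ℤ.pos-* ℤ.∣ p ∣ (suc d)) (ℤ.+≤+ (ℕ.m≤m*n ℤ.∣ p ∣ (suc d)))))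

  1/suc : ℕ → ℚ
  1/suc n = 1 /suc n

  0<1/suc : ∀ n → 0ℚ < 1/suc n
  0<1/suc n = 0</suc 0 n

  1/suc-antimono : ∀ {m n} → m ℕ.≤ n → 1/suc n ≤ 1/suc m
  1/suc-antimono {m} {n} m≤n = /suc-mono-≤ 1 n 1 m (ℕ.*-monoʳ-≤ 1 (ℕ.s≤s m≤n))

  opaque
    recip : ℚ → ℚ
    recip q with q ℚ.≟ 0ℚ
    ... | yes _   = 0ℚ
    ... | no  q≢0 = ℚ.1/_ q {{ℚ.≢-nonZero q≢0}}

    recip-inverse : ∀ {q} → 0ℚ < q → q * recip q ≡ 1ℚ
    recip-inverse {q} 0<q with q ℚ.≟ 0ℚ
    ... | yes refl = contradiction 0<q (ℚ.<-irrefl refl)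
    ... | no  q≢0  = ℚ.*-inverseʳ q {{ℚ.≢-nonZero q≢0}}

    0<recip : ∀ {q} → 0ℚ < q → 0ℚ < recip q
    0<recip {q} 0<q with q ℚ.≟ 0ℚ
    ... | yes refl = contradiction 0<q (ℚ.<-irrefl refl)
    ... | no  q≢0  = ℚ.positive⁻¹ _ {{ℚ.1/pos⇒pos q {{ℚ.positive 0<q}}}}

  recip-antimono : ∀ {p q} → 0ℚ < p → p ≤ q → recip q ≤ recip p
  recip-antimono {p} {q} 0<p p≤q = subst₂ _≤_
    (trans (solve 3 (λ p r s → p :* (r :* s) := s :* (p :* r)) refl p (recip p) (recip q))
      (trans (cong (recip q *_) (recip-inverse 0<p)) (ℚ.*-identityʳ (recip q))))
    (trans (solve 3 (λ q r s → q :* (r :* s) := r :* (q :* s)) refl q (recip p) (recip q))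
      (trans (cong (recip p *_) (recip-inverse 0<q)) (ℚ.*-identityʳ (recip p))))
    (*-monoʳ _ (ℚ.<⇒≤ (0<* (0<recip 0<p) (0<recip 0<q))) p≤q)
    where
    0<q = ℚ.<-≤-trans 0<p p≤q

  archimedean : ∀ c ε → 0ℚ < ε → ∃[ n ] c * 1/suc n ≤ ε
  archimedean c ε 0<ε = n , (begin
    c * 1/suc n                     ≡⟨ cong (_* 1/suc n) c≡ ⟩
    (ε * (c * i)) * 1/suc n         ≤⟨ *-monoʳ _ (ℚ.<⇒≤ (0<1/suc n))
                                        (*-monoˡ ε (ℚ.<⇒≤ 0<ε) (ℚ.≤-trans (≤-num (c * i)) (fromℕ-mono (ℕ.n≤1+n n)))) ⟩
    (ε * fromℕ (suc n)) * 1/suc n   ≡⟨ solve 3 (λ a b c → a :* b :* c := a :* (c :* b)) refl ε (fromℕ (suc n)) (1/suc n) ⟩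
    ε * (1/suc n * fromℕ (suc n))   ≡⟨ cong (ε *_) (trans (/suc-*-cancel 1 n) 1/suc0≡1) ⟩
    ε * 1ℚ                          ≡⟨ ℚ.*-identityʳ ε ⟩
    ε                               ∎)
    where
    open ℚ.≤-Reasoning
    i = recip ε
    n = ℤ.∣ ℚ.↥ (c * i) ∣
    c≡ : c ≡ ε * (c * i)
    c≡ = sym (trans (solve 3 (λ e c i → e :* (c :* i) := c :* (e :* i)) refl ε c i)
             (trans (cong (c *_) (recip-inverse 0<ε)) (ℚ.*-identityʳ c)))

  0≤^ : ∀ {x} → 0ℚ ≤ x → ∀ n → 0ℚ ≤ x ^ n
  0≤^ 0≤x zero    = 0≤1
  0≤^ 0≤x (suc n) = 0≤* 0≤x (0≤^ 0≤x n)

  0<^ : ∀ {x} → 0ℚ < x → ∀ n → 0ℚ < x ^ n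
  0<^ 0<x zero    = 0<1
  0<^ 0<x (suc n) = 0<* 0<x (0<^ 0<x n)

  ^-mono-≤ : ∀ {x y} → 0ℚ ≤ x → x ≤ y → ∀ n → x ^ n ≤ y ^ n
  ^-mono-≤ 0≤x x≤y zero    = ℚ.≤-refl
  ^-mono-≤ 0≤x x≤y (suc n) =
    *-mono 0≤x (0≤^ (ℚ.≤-trans 0≤x x≤y) n) x≤y (^-mono-≤ 0≤x x≤y n)

  ^-mono-< : ∀ {x y} → 0ℚ ≤ x → x < y → ∀ n .{{_ : NonZero n}} → x ^ n < y ^ n
  ^-mono-< {x} {y} 0≤x x<y (suc n) = ℚ.≤-<-trans
    (*-monoˡ x 0≤x (^-mono-≤ 0≤x (ℚ.<⇒≤ x<y) n))
    (ℚ.*-monoˡ-<-pos (y ^ n) {{positive (0<^ (ℚ.≤-<-trans 0≤x x<y) n)}} x<y)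

  ^-cancel-≤ : ∀ {x y} → 0ℚ ≤ y → ∀ n .{{_ : NonZero n}} → x ^ n ≤ y ^ n → x ≤ y
  ^-cancel-≤ {x} {y} 0≤y n h with x ℚ.≤? y
  ... | yes x≤y = x≤y
  ... | no  x≰y = contradiction (ℚ.<-≤-trans (^-mono-< 0≤y (ℚ.≰⇒> x≰y) n) h) (ℚ.<-irrefl refl)

  1≤^ : ∀ {x} → 1ℚ ≤ x → ∀ n → 1ℚ ≤ x ^ n
  1≤^ 1≤x zero    = ℚ.≤-refl
  1≤^ 1≤x (suc n) = *-mono 0≤1 (ℚ.≤-trans 0≤1 (1≤^ 1≤x n)) 1≤x (1≤^ 1≤x n)

  ≤^ : ∀ {x} → 1ℚ ≤ x → ∀ n .{{_ : NonZero n}} → x ≤ x ^ n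
  ≤^ {x} 1≤x (suc n) = subst (_≤ x * x ^ n) (ℚ.*-identityʳ x)
    (*-monoˡ x (ℚ.≤-trans 0≤1 1≤x) (1≤^ 1≤x n))

  ^≤1 : ∀ {x} → 0ℚ ≤ x → x ≤ 1ℚ → ∀ n → x ^ n ≤ 1ℚ
  ^≤1 0≤x x≤1 zero    = ℚ.≤-refl
  ^≤1 0≤x x≤1 (suc n) = *-mono 0≤x 0≤1 x≤1 (^≤1 0≤x x≤1 n)

  ^≤ : ∀ {x} → 0ℚ ≤ x → x ≤ 1ℚ → ∀ n .{{_ : NonZero n}} → x ^ n ≤ x
  ^≤ {x} 0≤x x≤1 (suc n) = subst (x * x ^ n ≤_) (ℚ.*-identityʳ x) (*-monoˡ x 0≤x (^≤1 0≤x x≤1 n))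

  bernoulli : ∀ {h} → 0ℚ ≤ h → ∀ n → 1ℚ + fromℕ n * h ≤ (1ℚ + h) ^ n
  bernoulli {h} 0≤h zero    = ℚ.≤-reflexive (cong (λ a → 1ℚ + a) (trans (cong (_* h) (0/suc≡0 0)) (ℚ.*-zeroˡ h)))
  bernoulli {h} 0≤h (suc n) = begin
    1ℚ + fromℕ (suc n) * h           ≡⟨ cong (λ a → 1ℚ + a * h) (fromℕ-suc n) ⟩
    1ℚ + (1ℚ + f) * h                ≡⟨ sym (ℚ.+-identityʳ _) ⟩
    1ℚ + (1ℚ + f) * h + 0ℚ           ≤⟨ ℚ.+-monoʳ-≤ (1ℚ + (1ℚ + f) * h) (0≤* (0≤* (0≤/suc n 0) 0≤h) 0≤h) ⟩
    1ℚ + (1ℚ + f) * h + f * h * h    ≡⟨ solve 2 (λ f h → con 1ℚ :+ (con 1ℚ :+ f) :* h :+ f :* h :* h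
                                          := (con 1ℚ :+ h) :* (con 1ℚ :+ f :* h)) refl f h ⟩
    (1ℚ + h) * (1ℚ + f * h)          ≤⟨ *-monoˡ (1ℚ + h) (0≤+ 0≤1 0≤h) (bernoulli 0≤h n) ⟩
    (1ℚ + h) * (1ℚ + h) ^ n          ∎
    where
    open ℚ.≤-Reasoning
    f = fromℕ n

  greatest : {P : ℕ → Set} → Decidable P → ℕ → ℕ
  greatest P? zero    = zero
  greatest P? (suc b) with P? (suc b)
  ... | yes _ = suc b
  ... | no  _ = greatest P? b

  greatest-correct : {P : ℕ → Set} (P? : Decidable P) → P zero → ∀ b → ¬ P (suc b) →
                     P (greatest P? b) × ¬ P (suc (greatest P? b))
  greatest-correct P? p₀ zero    ¬p = p₀ , ¬p
  greatest-correct P? p₀ (suc b) ¬p with P? (suc b)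
  ... | yes p  = p , ¬p
  ... | no  ¬q = greatest-correct P? p₀ b ¬q

  rootNumerator : (k q : ℕ) (x : ℚ) → ℕ
  rootNumerator k q x =
    greatest (λ t → (t /suc k) ^ q ℚ.≤? x) (suc k ℕ.* suc ℤ.∣ ℚ.↥ x ∣)

  rootNumerator-correct : ∀ k q .{{_ : NonZero q}} x → 0ℚ ≤ x →
                          (rootNumerator k q x /suc k) ^ q ≤ x × x < (rootNumerator k q x /suc k + 1/suc k) ^ q
  rootNumerator-correct k q x 0≤x = proj₁ bounds , subst (λ y → x < y ^ q) next (ℚ.≰⇒> (proj₂ bounds))
    where
    M = suc ℤ.∣ ℚ.↥ x ∣
    b = suc k ℕ.* M
    z = suc b /suc k

    0^ : ∀ n .{{_ : NonZero n}} → (0 /suc k) ^ n ≤ x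
    0^ (suc n) = subst (_≤ x) (sym (trans (cong (λ a → a * a ^ n) (0/suc≡0 k)) (ℚ.*-zeroˡ (0ℚ ^ n)))) 0≤x

    M<z : fromℕ M < z
    M<z = /suc-mono-< M 0 (suc b) k (subst (M ℕ.* suc k ℕ.<_) (sym (ℕ.*-identityʳ (suc b)))
      (ℕ.≤-reflexive (cong suc (ℕ.*-comm M (suc k)))))

    1≤z : 1ℚ ≤ z
    1≤z = subst (_≤ z) 1/suc0≡1 (ℚ.≤-trans (fromℕ-mono {1} {M} (ℕ.s≤s ℕ.z≤n)) (ℚ.<⇒≤ M<z))

    x<z^q : x < z ^ q
    x<z^q = ℚ.≤-<-trans (≤-num x) (ℚ.≤-<-trans (fromℕ-mono {ℤ.∣ ℚ.↥ x ∣} {M} (ℕ.n≤1+n _)) (ℚ.<-≤-trans M<z (≤^ 1≤z q)))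

    bounds : (rootNumerator k q x /suc k) ^ q ≤ x × ¬ (suc (rootNumerator k q x) /suc k) ^ q ≤ x
    bounds = greatest-correct (λ t → (t /suc k) ^ q ℚ.≤? x) (0^ q) b
      (λ le → ℚ.<-irrefl refl (ℚ.<-≤-trans x<z^q le))

    next : suc (rootNumerator k q x) /suc k ≡ rootNumerator k q x /suc k + 1/suc k
    next = trans (sym (/suc-+ 1 (rootNumerator k q x) k)) (ℚ.+-comm (1/suc k) (rootNumerator k q x /suc k))

  opaque
    -- For x ≥ 0 and q > 0, the largest multiple of 1/(k+1) whose q-th power
    -- is at most x; the bound given to `greatest` exceeds every candidate
    -- (see `root-correct`).
    root : (k q : ℕ) (x : ℚ) → ℚ
    root k q x = rootNumerator k q x /suc k

    0≤root : ∀ k q x → 0ℚ ≤ root k q x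
    0≤root k q x = 0≤/suc (rootNumerator k q x) k

    root-correct : ∀ k q .{{_ : NonZero q}} x → 0ℚ ≤ x →
                   root k q x ^ q ≤ x × x < (root k q x + 1/suc k) ^ q
    root-correct = rootNumerator-correct

  infixr 8 _^ℤ_

  _^ℤ_ : (d : ℕ) .{{_ : NonZero d}} → ℤ → ℚ
  d     ^ℤ (+ n)    = fromℕ d ^ n
  suc d ^ℤ -[1+ n ] = 1/suc d ^ suc n

  module _ (d-1 : ℕ) where
    private
      d = suc d-1
      D = fromℕ d
      E = 1/suc d-1

    E*D : E * D ≡ 1ℚ
    E*D = trans (/suc-*-cancel 1 d-1) 1/suc0≡1

    1≤D : 1ℚ ≤ D
    1≤D = subst (_≤ D) 1/suc0≡1 (fromℕ-mono {1} {d} (ℕ.s≤s ℕ.z≤n))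

    0<D : 0ℚ < D
    0<D = ℚ.<-≤-trans 0<1 1≤D

    E≤1 : E ≤ 1ℚ
    E≤1 = subst (E ≤_) 1/suc0≡1 (1/suc-antimono {0} {d-1} ℕ.z≤n)

    0<^ℤ : ∀ i → 0ℚ < d ^ℤ i
    0<^ℤ (+ n)    = 0<^ 0<D n
    0<^ℤ -[1+ n ] = 0<^ (0<1/suc d-1) (suc n)

    ^ℤ-suc : ∀ i → d ^ℤ (ℤ.suc i) ≡ D * d ^ℤ i
    ^ℤ-suc (+ n)          = refl
    ^ℤ-suc -[1+ zero ]    = sym (trans (cong (D *_) (ℚ.*-identityʳ E)) (trans (ℚ.*-comm D E) E*D))
    ^ℤ-suc -[1+ suc n ]   = sym (trans
      (solve 3 (λ D E x → D :* (E :* x) := (E :* D) :* x) refl D E (E ^ suc n))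
      (trans (cong (_* E ^ suc n) E*D) (ℚ.*-identityˡ (E ^ suc n))))

    ^ℤ-+ : ∀ i n → d ^ℤ (i ℤ.+ + n) ≡ d ^ℤ i * D ^ n
    ^ℤ-+ i zero    = trans (cong (d ^ℤ_) (ℤ.+-identityʳ i)) (sym (ℚ.*-identityʳ (d ^ℤ i)))
    ^ℤ-+ i (suc n) = trans (cong (d ^ℤ_) step) (trans (^ℤ-suc (i ℤ.+ + n))
      (trans (cong (D *_) (^ℤ-+ i n))
             (solve 3 (λ D a b → D :* (a :* b) := a :* (D :* b)) refl D (d ^ℤ i) (D ^ n))))
      where
      step : i ℤ.+ + suc n ≡ ℤ.suc (i ℤ.+ + n)
      step = trans (sym (ℤ.+-assoc i (+ 1) (+ n)))
             (trans (cong (ℤ._+ + n) (ℤ.+-comm i (+ 1))) (ℤ.+-assoc (+ 1) i (+ n)))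

    ^ℤ-mono : ∀ {i j} → i ℤ.≤ j → d ^ℤ i ≤ d ^ℤ j
    ^ℤ-mono {i} {j} i≤j = subst₂ _≤_ (ℚ.*-identityʳ (d ^ℤ i)) (trans (sym (^ℤ-+ i n)) (cong (d ^ℤ_) j≡))
      (*-monoˡ (d ^ℤ i) (ℚ.<⇒≤ (0<^ℤ i)) (1≤^ 1≤D n))
      where
      n = ℤ.∣ j ℤ.- i ∣
      j≡ : i ℤ.+ + n ≡ j
      j≡ = trans (cong (λ k → i ℤ.+ k) (ℤ.0≤i⇒+∣i∣≡i (ℤ.i≤j⇒0≤j-i i≤j)))
           (trans (cong (λ k → i ℤ.+ k) (ℤ.+-comm j (ℤ.- i)))
           (trans (sym (ℤ.+-assoc i (ℤ.- i) j))
           (trans (cong (ℤ._+ j) (ℤ.+-inverseʳ i)) (ℤ.+-identityˡ j))))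

    ^ℤ-* : ∀ i n → d ^ℤ (i ℤ.* + n) ≡ (d ^ℤ i) ^ n
    ^ℤ-* (+ m)    n       = trans (cong (d ^ℤ_) (sym (ℤ.pos-* m n))) (sym (^-assocʳ D m n))
    ^ℤ-* -[1+ m ] zero    = cong (d ^ℤ_) (ℤ.*-zeroʳ -[1+ m ])
    ^ℤ-* -[1+ m ] (suc n) = sym (^-assocʳ E (suc m) (suc n))

    clear : ∀ a b m → a ≤ b + 1/suc m →
            ℚ.↥ a ℤ.* + (ℚ.↧ₙ b ℕ.* suc m)
              ℤ.≤ ℚ.↥ b ℤ.* + (ℚ.↧ₙ a ℕ.* suc m) ℤ.+ + (ℚ.↧ₙ a ℕ.* ℚ.↧ₙ b)
    clear a@(ℚ.mkℚ p q-1 _) b@(ℚ.mkℚ r s-1 _) m a≤ =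
      ℤ.≤-trans (ℚᵘ.drop-*≤* {p = ℚ.toℚᵘ a} {q = ℚᵘ.mkℚᵘ r s-1 ℚᵘ.+ ℚᵘ.mkℚᵘ (+ 1) m}
          (ℚᵘ.≤-respʳ-≃ (ℚᵘ.≃-trans (ℚ.toℚᵘ-homo-+ b (1/suc m)) (ℚᵘ.+-cong (ℚᵘ.≃-refl {ℚ.toℚᵘ b}) (/suc-toℚᵘ 1 m)))
            (ℚ.toℚᵘ-mono-≤ a≤)))
        (ℤ.≤-reflexive eq)
      where
      q = suc q-1
      s = suc s-1
      M = suc m
      eq : (r ℤ.* + M ℤ.+ + 1 ℤ.* + s) ℤ.* + q ≡ r ℤ.* + (q ℕ.* M) ℤ.+ + (q ℕ.* s)
      eq = trans (ℤ.*-distribʳ-+ (+ q) (r ℤ.* + M) (+ 1 ℤ.* + s))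
           (cong₂ ℤ._+_
             (trans (ℤ.*-assoc r (+ M) (+ q)) (cong (r ℤ.*_) (trans (sym (ℤ.pos-* M q)) (cong +_ (ℕ.*-comm M q)))))
             (trans (cong (ℤ._* + q) (ℤ.*-identityˡ (+ s))) (trans (sym (ℤ.pos-* s q)) (cong +_ (ℕ.*-comm s q)))))

    -- With y ≤ d^a and d^b ≤ z written without roots: y ≤ d^{1/(m+1)} z,
    -- and d^{1/(m+1)} ≤ 1 + d/(m+1).
    compare : ∀ a b m {y z} → a ≤ b + 1/suc m → 0ℚ ≤ y → 0ℚ ≤ z →
              y ^ ℚ.↧ₙ a ≤ d ^ℤ (ℚ.↥ a) → d ^ℤ (ℚ.↥ b) ≤ z ^ ℚ.↧ₙ b →
              y ≤ (1ℚ + D * 1/suc m) * z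
    compare a b m {y} {z} a≤ 0≤y 0≤z hy hz = ^-cancel-≤ (0≤* 0≤1+h 0≤z) M (begin
      y ^ M                ≤⟨ yM ⟩
      D * z ^ M            ≤⟨ *-monoʳ (z ^ M) (0≤^ 0≤z M) D≤ ⟩
      (1ℚ + h) ^ M * z ^ M ≡⟨ sym (^-distrib-* (1ℚ + h) z M) ⟩
      ((1ℚ + h) * z) ^ M   ∎)
      where
      open ℚ.≤-Reasoning
      p = ℚ.↥ a
      q = ℚ.↧ₙ a
      r = ℚ.↥ b
      s = ℚ.↧ₙ b
      M = suc m
      h = D * 1/suc m

      0≤h : 0ℚ ≤ h
      0≤h = 0≤* (ℚ.<⇒≤ 0<D) (ℚ.<⇒≤ (0<1/suc m))

      0≤1+h : 0ℚ ≤ 1ℚ + h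
      0≤1+h = 0≤+ 0≤1 0≤h

      swap : ∀ x u v → x ^ (u ℕ.* v) ≡ x ^ (v ℕ.* u)
      swap x u v = cong (x ^_) (ℕ.*-comm u v)

      re : ∀ x u v w → (x ^ u) ^ (v ℕ.* w) ≡ (x ^ w) ^ (u ℕ.* v)
      re x u v w = trans (^-assocʳ x u (v ℕ.* w)) (trans
        (cong (x ^_) (trans (sym (ℕ.*-assoc u v w)) (ℕ.*-comm (u ℕ.* v) w))) (sym (^-assocʳ x w (u ℕ.* v))))

      D≤ : D ≤ (1ℚ + h) ^ M
      D≤ = begin
        D                   ≡⟨ sym (trans (cong (D *_) (trans (/suc-*-cancel 1 m) 1/suc0≡1)) (ℚ.*-identityʳ D)) ⟩
        D * (1/suc m * fromℕ M) ≡⟨ solve 3 (λ D e f → D :* (e :* f) := f :* (D :* e)) refl D (1/suc m) (fromℕ M) ⟩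
        fromℕ M * h         ≡⟨ sym (ℚ.+-identityˡ _) ⟩
        0ℚ + fromℕ M * h    ≤⟨ ℚ.+-monoˡ-≤ (fromℕ M * h) 0≤1 ⟩
        1ℚ + fromℕ M * h    ≤⟨ bernoulli 0≤h M ⟩
        (1ℚ + h) ^ M        ∎

      yM : y ^ M ≤ D * z ^ M
      yM = ^-cancel-≤ (0≤* (ℚ.<⇒≤ 0<D) (0≤^ 0≤z M)) (q ℕ.* s) {{ℕ.m*n≢0 q s}} (begin
        (y ^ M) ^ (q ℕ.* s)                    ≡⟨ sym (re y q s M) ⟩
        (y ^ q) ^ (s ℕ.* M)                    ≤⟨ ^-mono-≤ (0≤^ 0≤y q) hy (s ℕ.* M) ⟩
        (d ^ℤ p) ^ (s ℕ.* M)                   ≡⟨ sym (^ℤ-* p (s ℕ.* M)) ⟩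
        d ^ℤ (p ℤ.* + (s ℕ.* M))               ≤⟨ ^ℤ-mono (clear a b m a≤) ⟩
        d ^ℤ (r ℤ.* + (q ℕ.* M) ℤ.+ + (q ℕ.* s)) ≡⟨ ^ℤ-+ (r ℤ.* + (q ℕ.* M)) (q ℕ.* s) ⟩
        d ^ℤ (r ℤ.* + (q ℕ.* M)) * D ^ (q ℕ.* s) ≡⟨ cong (_* D ^ (q ℕ.* s)) (^ℤ-* r (q ℕ.* M)) ⟩
        (d ^ℤ r) ^ (q ℕ.* M) * D ^ (q ℕ.* s)   ≤⟨ *-monoʳ (D ^ (q ℕ.* s)) (0≤^ (ℚ.<⇒≤ 0<D) (q ℕ.* s))
                                                     (^-mono-≤ (ℚ.<⇒≤ (0<^ℤ r)) hz (q ℕ.* M)) ⟩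
        (z ^ s) ^ (q ℕ.* M) * D ^ (q ℕ.* s)    ≡⟨ cong (_* D ^ (q ℕ.* s)) (trans (re z s q M) (swap (z ^ M) s q)) ⟩
        (z ^ M) ^ (q ℕ.* s) * D ^ (q ℕ.* s)    ≡⟨ ℚ.*-comm ((z ^ M) ^ (q ℕ.* s)) (D ^ (q ℕ.* s)) ⟩
        D ^ (q ℕ.* s) * (z ^ M) ^ (q ℕ.* s)    ≡⟨ sym (^-distrib-* D (z ^ M) (q ℕ.* s)) ⟩
        (D * z ^ M) ^ (q ℕ.* s)                ∎)

    ∣^ℤ∣ : ∀ i q .{{_ : NonZero q}} → (E ^ ℤ.∣ i ∣) ^ q ≤ d ^ℤ i
    ∣^ℤ∣ i q = ℚ.≤-trans (^≤ (0≤^ 0≤E ℤ.∣ i ∣) (^≤1 0≤E E≤1 ℤ.∣ i ∣) q) (le i)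
      where
      0≤E = ℚ.<⇒≤ (0<1/suc d-1)
      le : ∀ i → E ^ ℤ.∣ i ∣ ≤ d ^ℤ i
      le (+ n)    = ℚ.≤-trans (^≤1 0≤E E≤1 n) (1≤^ 1≤D n)
      le -[1+ n ] = ℚ.≤-refl

  -- Truncation of d^a, for rational a, to a multiple of 1/(k+1).
  approxPower : (k d : ℕ) .{{_ : NonZero d}} → ℚ → ℚ
  approxPower k d a = root k (ℚ.↧ₙ a) (d ^ℤ (ℚ.↥ a))

  module _ (d-1 : ℕ) where
    private
      d = suc d-1
      D = fromℕ d

    0≤approxPower : ∀ k a → 0ℚ ≤ approxPower k d a
    0≤approxPower k a = 0≤root k (ℚ.↧ₙ a) (d ^ℤ (ℚ.↥ a))

    approxPower-correct : ∀ k a → approxPower k d a ^ ℚ.↧ₙ a ≤ d ^ℤ (ℚ.↥ a) ×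
                          d ^ℤ (ℚ.↥ a) < (approxPower k d a + 1/suc k) ^ ℚ.↧ₙ a
    approxPower-correct k a = root-correct k (ℚ.↧ₙ a) (d ^ℤ (ℚ.↥ a)) (ℚ.<⇒≤ (0<^ℤ d-1 (ℚ.↥ a)))

    below : ∀ a b l m {y} → a ≤ b + 1/suc m → 0ℚ ≤ y → y ^ ℚ.↧ₙ a ≤ d ^ℤ (ℚ.↥ a) →
            y ≤ (1ℚ + D * 1/suc m) * (approxPower l d b + 1/suc l)
    below a b l m a≤ 0≤y hy =
      compare d-1 a b m a≤ 0≤y (0≤+ (0≤approxPower l b) (ℚ.<⇒≤ (0<1/suc l))) hy
        (ℚ.<⇒≤ (proj₂ (approxPower-correct l b)))

    approxPower-≤ : ∀ a b k l m → a ≤ b + 1/suc m →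
                    approxPower k d a ≤ (1ℚ + D * 1/suc m) * (approxPower l d b + 1/suc l)
    approxPower-≤ a b k l m a≤ = below a b l m a≤ (0≤approxPower k a) (proj₁ (approxPower-correct k a))

    approxPower-lower : ∀ a → ∃[ c ] 0ℚ < c × (∀ b l → a ≤ b + 1/suc 0 → c ≤ approxPower l d b + 1/suc l)
    approxPower-lower a = i * y , 0<* 0<i 0<y , λ b l a≤ →
      let z = approxPower l d b + 1/suc l
      in subst (i * y ≤_)
           (trans (sym (ℚ.*-assoc i W z)) (trans (cong (_* z) (trans (ℚ.*-comm i W) (recip-inverse 0<W))) (ℚ.*-identityˡ z)))
           (*-monoˡ i (ℚ.<⇒≤ 0<i) (below a b l 0 a≤ (ℚ.<⇒≤ 0<y) (∣^ℤ∣ d-1 (ℚ.↥ a) (ℚ.↧ₙ a))))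
      where
      y = 1/suc d-1 ^ ℤ.∣ ℚ.↥ a ∣
      W = 1ℚ + D * 1/suc 0
      0<y : 0ℚ < y
      0<y = 0<^ (0<1/suc d-1) ℤ.∣ ℚ.↥ a ∣
      0<W : 0ℚ < W
      0<W = ℚ.+-mono-< 0<1 (0<* (0<D d-1) (0<1/suc 0))
      i = recip W
      0<i : 0ℚ < i
      0<i = 0<recip 0<W

module _ where
  open RationalPower using (0≤1; 0<1; 0<½; 0≤*; 0<*; 0≤+; *-monoˡ; *-monoʳ; *-mono; half+half; ∣-∣≤;
    ∣-∣⇒≤; ∣-∣-comm; 1/suc; 0<1/suc; 1/suc-antimono; archimedean; recip; recip-inverse; 0<recip;
    recip-antimono; approxPower; 0≤approxPower;
    approxPower-≤; approxPower-lower; 0<D)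
  open import Data.Rational.Base using (∣_∣)
  open import Data.Rational.Solver
  open +-*-Solver using (solve; _:+_; _:*_; :-_; _:=_; con)

  IsCauchy : (ℕ → ℚ) → Set
  IsCauchy x = ∀ ε → 0ℚ ℚ.< ε → ∃[ N ] ∀ m n → N ℕ.≤ m → N ℕ.≤ n → ∣ x m ℚ.- x n ∣ ℚ.≤ ε

  record ℝ : Set where
    constructor mkℝ
    field
      seq    : ℕ → ℚ
      cauchy : IsCauchy seq
  open ℝ public

  infix 4 _≈_ _≤_ _<_

  record _≈_ (x y : ℝ) : Set where
    constructor mk≈
    field
      close : ∀ ε → 0ℚ ℚ.< ε → ∃[ N ] ∀ n → N ℕ.≤ n → ∣ seq x n ℚ.- seq y n ∣ ℚ.≤ ε
  open _≈_ public

  record _≤_ (x y : ℝ) : Set where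
    constructor mk≤
    field
      bound : ∀ ε → 0ℚ ℚ.< ε → ∃[ N ] ∀ n → N ℕ.≤ n → seq x n ℚ.≤ seq y n ℚ.+ ε
  open _≤_ public

  record _<_ (x y : ℝ) : Set where
    constructor mk<
    field
      gap       : ℚ
      gap>0     : 0ℚ ℚ.< gap
      from      : ℕ
      separated : ∀ n → from ℕ.≤ n → seq x n ℚ.+ gap ℚ.≤ seq y n
  open _<_ public

  fromℚ : ℚ → ℝ
  fromℚ q = mkℝ (λ _ → q) λ ε 0<ε → 0 , λ _ _ _ _ →
    subst (ℚ._≤ ε) (cong ∣_∣ (sym (ℚ.+-inverseʳ q))) (ℚ.<⇒≤ 0<ε)

  0ℝ 1ℝ 2ℝ : ℝ
  0ℝ = fromℚ 0ℚ
  1ℝ = fromℚ 1ℚ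
  2ℝ = fromℚ (+ 2 ℚ./ 1)

  infixl 6 _+_
  infixl 7 _*_ _/_
  infix  8 -_

  private
    ⊔≤ˡ : ∀ {m n o} → m ℕ.⊔ n ℕ.≤ o → m ℕ.≤ o
    ⊔≤ˡ = ℕ.m⊔n≤o⇒m≤o _ _

    ⊔≤ʳ : ∀ {m n o} → m ℕ.⊔ n ℕ.≤ o → n ℕ.≤ o
    ⊔≤ʳ = ℕ.m⊔n≤o⇒n≤o _ _

    ½pos : ∀ {ε} → 0ℚ ℚ.< ε → 0ℚ ℚ.< ½ ℚ.* ε
    ½pos = 0<* 0<½

    ∣+∣≤ : ∀ {a b c d} → ∣ a ∣ ℚ.≤ c → ∣ b ∣ ℚ.≤ d → ∣ a ℚ.+ b ∣ ℚ.≤ c ℚ.+ d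
    ∣+∣≤ {a} {b} h h′ = ℚ.≤-trans (ℚ.∣p+q∣≤∣p∣+∣q∣ a b) (ℚ.+-mono-≤ h h′)

    ∣*∣≤ : ∀ {a b c d} → ∣ a ∣ ℚ.≤ c → ∣ b ∣ ℚ.≤ d → ∣ a ℚ.* b ∣ ℚ.≤ c ℚ.* d
    ∣*∣≤ {a} {b} h h′ = ℚ.≤-trans (ℚ.≤-reflexive (ℚ.∣p*q∣≡∣p∣*∣q∣ a b))
      (*-mono (ℚ.0≤∣p∣ a) (ℚ.≤-trans (ℚ.0≤∣p∣ b) h′) h h′)

  _+_ : ℝ → ℝ → ℝ
  x + y = mkℝ (λ n → seq x n ℚ.+ seq y n) λ ε 0<ε →
    let N₁ , h₁ = cauchy x (½ ℚ.* ε) (½pos 0<ε)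
        N₂ , h₂ = cauchy y (½ ℚ.* ε) (½pos 0<ε)
    in N₁ ℕ.⊔ N₂ , λ m n N≤m N≤n → subst₂ ℚ._≤_
      (cong ∣_∣ (solve 4 (λ a b c d → (a :+ (:- c)) :+ (b :+ (:- d)) := (a :+ b) :+ (:- (c :+ d))) refl
        (seq x m) (seq y m) (seq x n) (seq y n)))
      (half+half ε)
      (∣+∣≤ (h₁ m n (⊔≤ˡ N≤m) (⊔≤ˡ N≤n)) (h₂ m n (⊔≤ʳ {N₁} N≤m) (⊔≤ʳ {N₁} N≤n)))

  -_ : ℝ → ℝ
  - x = mkℝ (λ n → ℚ.- seq x n) λ ε 0<ε →
    let N , h = cauchy x ε 0<ε
    in N , λ m n N≤m N≤n → subst (ℚ._≤ ε)
      (trans (∣-∣-comm (seq x m) (seq x n))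
        (cong ∣_∣ (solve 2 (λ a b → b :+ (:- a) := (:- a) :+ (:- (:- b))) refl (seq x m) (seq x n))))
      (h m n N≤m N≤n)

  eventually-bounded : ∀ x → ∃[ B ] ∃[ N ] ∀ n → N ℕ.≤ n → ∣ seq x n ∣ ℚ.≤ B
  eventually-bounded x =
    let N , h = cauchy x 1ℚ 0<1
    in 1ℚ ℚ.+ ∣ seq x N ∣ , N , λ n N≤n → subst (λ z → ∣ z ∣ ℚ.≤ 1ℚ ℚ.+ ∣ seq x N ∣)
      (solve 2 (λ a b → (a :+ (:- b)) :+ b := a) refl (seq x n) (seq x N))
      (∣+∣≤ (h n N N≤n ℕ.≤-refl) ℚ.≤-refl)

  _*_ : ℝ → ℝ → ℝ
  x * y = mkℝ (λ n → seq x n ℚ.* seq y n) λ ε 0<ε →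
    let A , N₁ , hA = eventually-bounded x
        B , N₂ , hB = eventually-bounded y
        p , hp = archimedean A (½ ℚ.* ε) (½pos 0<ε)
        q , hq = archimedean B (½ ℚ.* ε) (½pos 0<ε)
        N₃ , hx = cauchy x (1/suc q) (0<1/suc q)
        N₄ , hy = cauchy y (1/suc p) (0<1/suc p)
    in (N₁ ℕ.⊔ N₂) ℕ.⊔ (N₃ ℕ.⊔ N₄) , λ m n N≤m N≤n → subst₂ ℚ._≤_
      (cong ∣_∣ (solve 4 (λ a b c d → a :* (b :+ (:- d)) :+ d :* (a :+ (:- c)) := a :* b :+ (:- (c :* d))) refl
        (seq x m) (seq y m) (seq x n) (seq y n)))
      (half+half ε)
      (∣+∣≤ (ℚ.≤-trans (∣*∣≤ (hA m (⊔≤ˡ (⊔≤ˡ N≤m)))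
                             (hy m n (⊔≤ʳ {N₃} (⊔≤ʳ {N₁ ℕ.⊔ N₂} N≤m)) (⊔≤ʳ {N₃} (⊔≤ʳ {N₁ ℕ.⊔ N₂} N≤n)))) hp)
            (ℚ.≤-trans (∣*∣≤ (hB n (⊔≤ʳ {N₁} (⊔≤ˡ N≤n)))
                             (hx m n (⊔≤ˡ (⊔≤ʳ {N₁ ℕ.⊔ N₂} N≤m)) (⊔≤ˡ (⊔≤ʳ {N₁ ℕ.⊔ N₂} N≤n)))) hq))

  recip-cauchy : ∀ x → 0ℝ < x → IsCauchy (λ n → recip (seq x n))
  recip-cauchy x 0<x ε 0<ε = N₁ ℕ.⊔ N₂ , λ m n N≤m N≤n → close′ m n N≤m N≤n
    where
    c  = gap 0<x
    J  = recip c
    N₁ = from 0<x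
    p  = proj₁ (archimedean (J ℚ.* J) ε 0<ε)
    N₂ = proj₁ (cauchy x (1/suc p) (0<1/suc p))

    c≤ : ∀ {n} → N₁ ℕ.≤ n → c ℚ.≤ seq x n
    c≤ {n} N≤n = subst (ℚ._≤ seq x n) (ℚ.+-identityˡ c) (separated 0<x n N≤n)

    0<xₙ : ∀ {n} → N₁ ℕ.≤ n → 0ℚ ℚ.< seq x n
    0<xₙ N≤n = ℚ.<-≤-trans (gap>0 0<x) (c≤ N≤n)

    ∣recip∣≤ : ∀ {n} → N₁ ℕ.≤ n → ∣ recip (seq x n) ∣ ℚ.≤ J
    ∣recip∣≤ N≤n = subst (ℚ._≤ J) (sym (ℚ.0≤p⇒∣p∣≡p (ℚ.<⇒≤ (0<recip (0<xₙ N≤n)))))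
      (recip-antimono (gap>0 0<x) (c≤ N≤n))

    difference : ∀ {a b} → 0ℚ ℚ.< a → 0ℚ ℚ.< b →
                 recip a ℚ.* recip b ℚ.* (b ℚ.- a) ≡ recip a ℚ.- recip b
    difference {a} {b} 0<a 0<b = trans
      (solve 4 (λ a b r s → r :* s :* (b :+ (:- a)) := r :* (b :* s) :+ (:- (s :* (a :* r)))) refl a b (recip a) (recip b))
      (cong₂ ℚ._-_ (trans (cong (recip a ℚ.*_) (recip-inverse 0<b)) (ℚ.*-identityʳ (recip a)))
                   (trans (cong (recip b ℚ.*_) (recip-inverse 0<a)) (ℚ.*-identityʳ (recip b))))

    close′ : ∀ m n → N₁ ℕ.⊔ N₂ ℕ.≤ m → N₁ ℕ.⊔ N₂ ℕ.≤ n →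
             ∣ recip (seq x m) ℚ.- recip (seq x n) ∣ ℚ.≤ ε
    close′ m n N≤m N≤n = ℚ.≤-trans
      (subst (λ z → ∣ z ∣ ℚ.≤ J ℚ.* J ℚ.* 1/suc p) (difference (0<xₙ (⊔≤ˡ N≤m)) (0<xₙ (⊔≤ˡ N≤n)))
        (∣*∣≤ (∣*∣≤ (∣recip∣≤ (⊔≤ˡ N≤m)) (∣recip∣≤ (⊔≤ˡ N≤n)))
              (proj₂ (cauchy x (1/suc p) (0<1/suc p)) n m (⊔≤ʳ {N₁} N≤n) (⊔≤ʳ {N₁} N≤m))))
      (proj₂ (archimedean (J ℚ.* J) ε 0<ε))

  _/_ : (x y : ℝ) → {{0ℝ < y}} → ℝ
  (x / y) {{0<y}} = x * mkℝ (λ n → recip (seq y n)) (recip-cauchy y 0<y)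

  approxPower-cauchy : ∀ d .{{_ : NonZero d}} (a : ℝ) → IsCauchy (λ k → approxPower k d (seq a k))
  approxPower-cauchy (suc d-1) a ε 0<ε = N , λ k l N≤k N≤l → ∣-∣≤ (half k l N≤k N≤l) (half l k N≤l N≤k)
    where
    open ℚ.≤-Reasoning
    d = suc d-1
    D = RationalPower.fromℕ d

    y : ℕ → ℚ
    y k = approxPower k d (seq a k)

    0≤D : 0ℚ ℚ.≤ D
    0≤D = ℚ.<⇒≤ (0<D d-1)

    K  = proj₁ (cauchy a (1/suc 0) (0<1/suc 0))
    U  = (1ℚ ℚ.+ D ℚ.* 1/suc 0) ℚ.* (y K ℚ.+ 1/suc K)
    m  = proj₁ (archimedean (D ℚ.* U) (½ ℚ.* ε) (½pos 0<ε))
    e  = 1/suc m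
    N₁ = proj₁ (cauchy a e (0<1/suc m))
    N₂ = proj₁ (archimedean (1ℚ ℚ.+ D) (½ ℚ.* ε) (½pos 0<ε))
    N  = K ℕ.⊔ (N₁ ℕ.⊔ N₂)

    0≤e : 0ℚ ℚ.≤ e
    0≤e = ℚ.<⇒≤ (0<1/suc m)

    e≤1 : e ℚ.≤ 1ℚ
    e≤1 = subst (e ℚ.≤_) RationalPower.1/suc0≡1 (1/suc-antimono {0} {m} ℕ.z≤n)

    y≤U : ∀ k → K ℕ.≤ k → y k ℚ.≤ U
    y≤U k K≤k = approxPower-≤ d-1 (seq a k) (seq a K) k K 0
      (∣-∣⇒≤ (proj₂ (cauchy a (1/suc 0) (0<1/suc 0)) k K K≤k ℕ.≤-refl))

    half : ∀ k l → N ℕ.≤ k → N ℕ.≤ l → y k ℚ.≤ y l ℚ.+ ε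
    half k l N≤k N≤l = begin
      y k
        ≤⟨ approxPower-≤ d-1 (seq a k) (seq a l) k l m
             (∣-∣⇒≤ (proj₂ (cauchy a e (0<1/suc m)) k l (⊔≤ˡ (⊔≤ʳ {K} N≤k)) (⊔≤ˡ (⊔≤ʳ {K} N≤l)))) ⟩
      (1ℚ ℚ.+ D ℚ.* e) ℚ.* (y l ℚ.+ 1/suc l)
        ≡⟨ solve 4 (λ D e y f → (con 1ℚ :+ D :* e) :* (y :+ f) := y :+ (D :* y :* e :+ (con 1ℚ :+ D :* e) :* f))
             refl D e (y l) (1/suc l) ⟩
      y l ℚ.+ (D ℚ.* y l ℚ.* e ℚ.+ (1ℚ ℚ.+ D ℚ.* e) ℚ.* 1/suc l)
        ≤⟨ ℚ.+-monoʳ-≤ (y l) (ℚ.+-mono-≤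
             (ℚ.≤-trans (*-monoʳ e 0≤e (*-monoˡ D 0≤D (y≤U l (⊔≤ˡ N≤l))))
               (proj₂ (archimedean (D ℚ.* U) (½ ℚ.* ε) (½pos 0<ε))))
             (ℚ.≤-trans (*-mono (0≤+ 0≤1 (0≤* 0≤D 0≤e)) (ℚ.<⇒≤ (0<1/suc N₂))
                 (ℚ.+-monoʳ-≤ 1ℚ (subst (D ℚ.* e ℚ.≤_) (ℚ.*-identityʳ D) (*-monoˡ D 0≤D e≤1)))
                 (1/suc-antimono (⊔≤ʳ {N₁} (⊔≤ʳ {K} N≤l))))
               (proj₂ (archimedean (1ℚ ℚ.+ D) (½ ℚ.* ε) (½pos 0<ε))))) ⟩
      y l ℚ.+ (½ ℚ.* ε ℚ.+ ½ ℚ.* ε)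
        ≡⟨ cong (λ z → y l ℚ.+ z) (half+half ε) ⟩
      y l ℚ.+ ε ∎

  infixr 8 _^_

  -- d^a = lim d^{aₖ} for the rationals aₖ → a, the k-th term being
  -- truncated to a multiple of 1/(k+1).
  _^_ : (d : ℕ) .{{_ : NonZero d}} → ℝ → ℝ
  d ^ a = mkℝ (λ k → approxPower k d (seq a k)) (approxPower-cauchy d a)

  ^-positive : ∀ d .{{_ : NonZero d}} a → 0ℝ < d ^ a
  ^-positive (suc d-1) a = mk< (½ ℚ.* c) (½pos 0<c) (K ℕ.⊔ N) λ l h →
    subst (ℚ._≤ approxPower l (suc d-1) (seq a l)) (sym (ℚ.+-identityˡ (½ ℚ.* c))) (low l h)
    where
    K   = proj₁ (cauchy a (1/suc 0) (0<1/suc 0))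
    c   = proj₁ (approxPower-lower d-1 (seq a K))
    0<c = proj₁ (proj₂ (approxPower-lower d-1 (seq a K)))
    N   = proj₁ (archimedean 1ℚ (½ ℚ.* c) (½pos 0<c))

    low : ∀ l → K ℕ.⊔ N ℕ.≤ l → ½ ℚ.* c ℚ.≤ approxPower l (suc d-1) (seq a l)
    low l h = subst₂ ℚ._≤_
      (trans (cong (ℚ._+ ℚ.- (½ ℚ.* c)) (sym (half+half c)))
        (solve 1 (λ b → (b :+ b) :+ (:- b) := b) refl (½ ℚ.* c)))
      (solve 2 (λ y b → (y :+ b) :+ (:- b) := y) refl (approxPower l (suc d-1) (seq a l)) (½ ℚ.* c))
      (ℚ.+-monoˡ-≤ (ℚ.- (½ ℚ.* c)) (ℚ.≤-trans
        (proj₂ (proj₂ (approxPower-lower d-1 (seq a K))) (seq a l) l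
          (∣-∣⇒≤ (proj₂ (cauchy a (1/suc 0) (0<1/suc 0)) K l ℕ.≤-refl (⊔≤ˡ h))))
        (ℚ.+-monoʳ-≤ (approxPower l (suc d-1) (seq a l))
          (ℚ.≤-trans (1/suc-antimono (⊔≤ʳ {K} h))
            (ℚ.≤-trans (ℚ.≤-reflexive (sym (ℚ.*-identityˡ (1/suc N))))
              (proj₂ (archimedean 1ℚ (½ ℚ.* c) (½pos 0<c))))))))

record Graph (n : ℕ) : Set where
  field
    adjacent   : Fin n → Fin n → Bool
    symmetric  : ∀ u v → adjacent u v ≡ adjacent v u
    loopless   : ∀ v → adjacent v v ≡ false

module _ {n : ℕ} (G : Graph n) where
  open Graph G

  degree : Fin n → ℕ
  degree v = length (filterᵇ (adjacent v) (allFin n))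

  -- Each edge uv appears once, as the pair with u < v.
  edges : List (Fin n × Fin n)
  edges = filterᵇ (λ (u , v) → (Fin.toℕ u ℕ.<ᵇ Fin.toℕ v) ∧ adjacent u v)
                  (cartesianProduct (allFin n) (allFin n))

  IsMinimumDegree : ℕ → Set
  IsMinimumDegree δ = (∃[ v ] degree v ≡ δ) × (∀ v → δ ℕ.≤ degree v)

  IsMaximumDegree : ℕ → Set
  IsMaximumDegree Δ = (∃[ v ] degree v ≡ Δ) × (∀ v → degree v ℕ.≤ Δ)

  Regular : Set
  Regular = ∀ u v → degree u ≡ degree v

  record NoIsolatedVertex : Set where
    field
      degree≢0 : ∀ v → NonZero (degree v)

sum : {A : Set} → List A → (A → ℝ) → ℝ
sum xs f = foldr (λ x s → f x + s) 0ℝ xs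

module _ {n : ℕ} (G : Graph n) {{noIsolated : NoIsolatedVertex G}} where
  private
    instance
      degree-nonZero : ∀ {v} → NonZero (degree G v)
      degree-nonZero {v} = NoIsolatedVertex.degree≢0 noIsolated v

      product-nonZero : ∀ {u v} → NonZero (degree G u ℕ.* degree G v)
      product-nonZero {u} {v} = ℕ.m*n≢0 (degree G u) (degree G v)

      power-positive : ∀ {v a} → 0ℝ < degree G v ^ a
      power-positive {v} {a} = ^-positive (degree G v) a

  SDD : ℝ → ℝ
  SDD α = sum (edges G) λ (u , v) →
    degree G u ^ α / degree G v ^ α + degree G v ^ α / degree G u ^ α

  M₁ : ℝ → ℝ
  M₁ a = sum (allFin n) λ u → degree G u ^ a

  M₂ : ℝ → ℝ
  M₂ a = sum (edges G) λ (u , v) → (degree G u ℕ.* degree G v) ^ a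

{-# OPTIONS --safe #-}

-- With p_u = d_u^{2α} and q_uv = (d_u d_v)^{-α}, each edge contributes (p_u + p_v) q_uv to SDD_α.
-- Bounding p_u + p_v by 2δ^{2α} or 2Δ^{2α} gives the bounds with M₂.  Bounding q_uv by δ^{-2α} or
-- Δ^{-2α} gives those with M₁, because Σ_{uv ∈ E} (p_u + p_v) = Σ_u d_u p_u.  All four bounds hold
-- edge by edge, so equality of the sums forces equality on each edge, and d ↦ d^a is injective for
-- a > 0.  There are no isolated vertices, so this determines every degree.
module Submission where

open import Data.Bool.Base using (Bool; true; false; _∧_; if_then_else_)
open import Data.Bool.Properties using (T?; T-≡; T-∧)
open import Data.Fin.Base as Fin using (Fin)
import Data.Fin.Properties as Fin
open import Data.Integer.Base as ℤ using (+_; -[1+_])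
import Data.Integer.Properties as ℤ
open import Data.List.Base using (List; []; _∷_; _++_; foldr; map; length; filterᵇ; allFin; cartesianProduct)
open import Data.List.Membership.Propositional using (_∈_)
open import Data.List.Membership.Propositional.Properties using (∈-filter⁺; ∈-cartesianProduct⁺; ∈-allFin)
open import Data.List.Relation.Unary.Any using (here; there)
open import Data.Nat.Base as ℕ using (ℕ; zero; suc; NonZero)
import Data.Nat.Properties as ℕ
open import Data.Product.Base using (_×_; _,_; proj₁; proj₂; ∃-syntax)
open import Data.Rational.Base as ℚ using (ℚ; 0ℚ; 1ℚ; ½; ∣_∣)
import Data.Rational.Properties as ℚ
open import Data.Rational.Solver
import Data.Rational.Unnormalised.Properties as ℚᵘ
open import Data.Sum.Base using (_⊎_; inj₁; inj₂)
open import Function.Base using (_∘_; flip)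
open import Function.Bundles using (_⇔_; mk⇔; Equivalence)
open import Relation.Binary.Bundles using (Poset)
open import Relation.Binary.Definitions using (tri<; tri≈; tri>)
open import Relation.Binary.PropositionalEquality hiding ([_])
import Relation.Binary.Reasoning.PartialOrder
open import Relation.Nullary using (¬_; yes; no; contradiction)
open import Defs
open RationalPower using (_^ℤ_; fromℕ; 1/suc; E*D; ^ℤ-+; ^ℤ-*; ^-distrib-*; ^-assocʳ; 0≤^; 0<^ℤ;
  ^-mono-≤; ^-cancel-≤; *-mono; *-monoˡ; *-monoʳ; 0≤*; 0<*; 0≤+; 0≤1; 0<½; half+half; ∣-∣≤; ∣-∣⇒≤;
  ≤∣∣; ∣-∣-comm; archimedean; 0<1/suc; 1/suc-antimono; /suc-+; 0/suc≡0; 0≤/suc; 0</suc; fromℕ-suc;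
  fromℕ-mono; approxPower; 0≤approxPower; approxPower-correct; recip-inverse)
  renaming (_^_ to _^ℕ_)
open +-*-Solver using (solve; _:+_; _:*_; :-_; _:=_; con)

-- Implicit real arguments are mostly given explicitly: _+_, _*_ and _^_ on ℝ are not injective for
-- the type checker, which would otherwise unfold them down to their Cauchy moduli.

-- `d ^ a` is accessible only through truncated roots: at an exponent term p/q, the k-th term y
-- satisfies y^q ≤ d^p < (y + 1/(k+1))^q. Truncation does not respect products, so the laws of
-- exponents need not hold term by term. Each is proved as two inequalities between rationals with
-- the roots cleared: the terms themselves are lower approximations, the terms enlarged by 1/(k+1)
-- are upper ones. The order on Cauchy reals is not decidable, so an equality case cannot be settled
-- by "otherwise the inequality is strict". Equality of two sums is instead carried to single edges
-- by cancellation, and from powers back to degrees, where the order is decidable. Injectivity of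
-- the power in its base likewise uses no logarithm and no strict monotonicity: once a multiple of
-- the exponent reaches 1, a whole factor d or e can be split off, and comparing the powers becomes
-- comparing naturals.

private variable
  A B : Set

-- Rational powers

1^ℕ : ∀ n → 1ℚ ^ℕ n ≡ 1ℚ
1^ℕ zero    = refl
1^ℕ (suc n) = trans (ℚ.*-identityˡ (1ℚ ^ℕ n)) (1^ℕ n)

1/suc^*fromℕ^ : ∀ d n → 1/suc d ^ℕ n ℚ.* fromℕ (suc d) ^ℕ n ≡ 1ℚ
1/suc^*fromℕ^ d n = trans (sym (^-distrib-* (1/suc d) (fromℕ (suc d)) n)) (trans (cong (_^ℕ n) (E*D d)) (1^ℕ n))

-- `^ℤ-+` covers a natural second exponent. For a negative one, the factor `e * D`, equal to 1, is
-- inserted, and `^ℤ-+` uses `D` to raise the exponent back to `i`.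
^ℤ-homo-+ : ∀ d .{{_ : NonZero d}} i j → d ^ℤ (i ℤ.+ j) ≡ d ^ℤ i ℚ.* d ^ℤ j
^ℤ-homo-+ (suc d) i (+ n)    = ^ℤ-+ d i n
^ℤ-homo-+ (suc d) i -[1+ n ] = begin
  suc d ^ℤ (i ℤ.+ -[1+ n ])           ≡⟨ sym (ℚ.*-identityʳ _) ⟩
  y ℚ.* 1ℚ                            ≡⟨ cong (y ℚ.*_) (sym (1/suc^*fromℕ^ d m)) ⟩
  y ℚ.* (e ℚ.* D)                     ≡⟨ solve 3 (λ y e D → y :* (e :* D) := (y :* D) :* e) refl y e D ⟩
  y ℚ.* D ℚ.* e                       ≡⟨ cong (ℚ._* e) (sym (^ℤ-+ d (i ℤ.+ -[1+ n ]) m)) ⟩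
  suc d ^ℤ (i ℤ.+ -[1+ n ] ℤ.+ + m) ℚ.* e
    ≡⟨ cong (λ k → suc d ^ℤ k ℚ.* e) (trans (ℤ.+-assoc i -[1+ n ] (+ m))
         (trans (cong (λ k → i ℤ.+ k) (ℤ.+-inverseˡ (+ m))) (ℤ.+-identityʳ i))) ⟩
  suc d ^ℤ i ℚ.* e                    ∎
  where
  open ≡-Reasoning
  m = suc n
  y = suc d ^ℤ (i ℤ.+ -[1+ n ])
  e = 1/suc d ^ℕ m
  D = fromℕ (suc d) ^ℕ m

fromℕ-+ : ∀ m n → fromℕ (m ℕ.+ n) ≡ fromℕ m ℚ.+ fromℕ n
fromℕ-+ m n = sym (/suc-+ m n 0)

fromℕ-* : ∀ m n → fromℕ (m ℕ.* n) ≡ fromℕ m ℚ.* fromℕ n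
fromℕ-* zero    n = trans (0/suc≡0 0) (sym (trans (cong (ℚ._* fromℕ n) (0/suc≡0 0)) (ℚ.*-zeroˡ (fromℕ n))))
fromℕ-* (suc m) n = begin
  fromℕ (n ℕ.+ m ℕ.* n)               ≡⟨ fromℕ-+ n (m ℕ.* n) ⟩
  fromℕ n ℚ.+ fromℕ (m ℕ.* n)         ≡⟨ cong (λ x → fromℕ n ℚ.+ x) (fromℕ-* m n) ⟩
  fromℕ n ℚ.+ fromℕ m ℚ.* fromℕ n     ≡⟨ solve 2 (λ m n → n :+ m :* n := (con 1ℚ :+ m) :* n) refl (fromℕ m) (fromℕ n) ⟩
  (1ℚ ℚ.+ fromℕ m) ℚ.* fromℕ n        ≡⟨ cong (ℚ._* fromℕ n) (sym (fromℕ-suc m)) ⟩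
  fromℕ (suc m) ℚ.* fromℕ n           ∎
  where open ≡-Reasoning

-- The index `e + d * suc e` is the predecessor of `suc d * suc e`. As `_/suc_` is opaque, the two
-- sides are identified as inverses of the same product `D * E`.
1/suc-* : ∀ d e → 1/suc (e ℕ.+ d ℕ.* suc e) ≡ 1/suc d ℚ.* 1/suc e
1/suc-* d e = begin
  g                                   ≡⟨ sym (trans (cong₂ (λ x y → g ℚ.* (x ℚ.* y)) (E*D d) (E*D e))
                                             (trans (cong (g ℚ.*_) (ℚ.*-identityˡ 1ℚ)) (ℚ.*-identityʳ g))) ⟩
  g ℚ.* ((x ℚ.* D) ℚ.* (y ℚ.* E))
    ≡⟨ solve 5 (λ g x D y E → g :* ((x :* D) :* (y :* E)) := (g :* (D :* E)) :* (x :* y)) refl g x D y E ⟩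
  (g ℚ.* (D ℚ.* E)) ℚ.* (x ℚ.* y)
    ≡⟨ cong (ℚ._* (x ℚ.* y)) (trans (cong (g ℚ.*_) (sym (fromℕ-* (suc d) (suc e)))) (E*D (e ℕ.+ d ℕ.* suc e))) ⟩
  1ℚ ℚ.* (x ℚ.* y)                    ≡⟨ ℚ.*-identityˡ _ ⟩
  x ℚ.* y                             ∎
  where
  open ≡-Reasoning
  g = 1/suc (e ℕ.+ d ℕ.* suc e)
  x = 1/suc d
  y = 1/suc e
  D = fromℕ (suc d)
  E = fromℕ (suc e)

^ℤ-distrib-* : ∀ d e .{{_ : NonZero d}} .{{_ : NonZero e}} .{{_ : NonZero (d ℕ.* e)}} i →
               (d ℕ.* e) ^ℤ i ≡ d ^ℤ i ℚ.* e ^ℤ i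
^ℤ-distrib-* (suc d) (suc e) (+ n)    =
  trans (cong (_^ℕ n) (fromℕ-* (suc d) (suc e))) (^-distrib-* (fromℕ (suc d)) (fromℕ (suc e)) n)
^ℤ-distrib-* (suc d) (suc e) -[1+ n ] =
  trans (cong (_^ℕ suc n) (1/suc-* d e)) (^-distrib-* (1/suc d) (1/suc e) (suc n))

0≤^ℤ : ∀ d .{{_ : NonZero d}} i → 0ℚ ℚ.≤ d ^ℤ i
0≤^ℤ (suc d) i = ℚ.<⇒≤ (0<^ℤ d i)

^ℤ-assocʳ : ∀ d .{{_ : NonZero d}} i n → d ^ℤ (i ℤ.* + n) ≡ (d ^ℤ i) ^ℕ n
^ℤ-assocʳ (suc d) = ^ℤ-* d

-- x ≤ d^a and x ≥ d^a, with denominators cleared, obey the same algebra: _≲_ stands for either order.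
module RationalPowerComparison (_≲_ : ℚ → ℚ → Set)
  (^-mono   : ∀ {x y} → 0ℚ ℚ.≤ x → 0ℚ ℚ.≤ y → x ≲ y → ∀ n → (x ^ℕ n) ≲ (y ^ℕ n))
  (^-cancel : ∀ {x y} → 0ℚ ℚ.≤ x → 0ℚ ℚ.≤ y → ∀ n .{{_ : NonZero n}} → (x ^ℕ n) ≲ (y ^ℕ n) → x ≲ y)
  (*-mono-≲ : ∀ {x y z w} → 0ℚ ℚ.≤ x → 0ℚ ℚ.≤ y → 0ℚ ℚ.≤ z → 0ℚ ℚ.≤ w → x ≲ y → z ≲ w → (x ℚ.* z) ≲ (y ℚ.* w))
  where

  ComparesTo : (d : ℕ) .{{_ : NonZero d}} → ℚ → ℚ → Set
  ComparesTo d a x = (x ^ℕ ℚ.↧ₙ a) ≲ (d ^ℤ ℚ.↥ a)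

  -- The comparison does not depend on the fraction representing the exponent.
  rescale : ∀ d .{{_ : NonZero d}} p q p′ q′ .{{_ : NonZero q}} {x} → 0ℚ ℚ.≤ x → p ℤ.* + q′ ≡ p′ ℤ.* + q →
            (x ^ℕ q) ≲ (d ^ℤ p) → (x ^ℕ q′) ≲ (d ^ℤ p′)
  rescale d p q p′ q′ {x} 0≤x eq h = ^-cancel (0≤^ 0≤x q′) (0≤^ℤ d p′) q
    (subst₂ _≲_
      (trans (^-assocʳ x q q′) (trans (cong (x ^ℕ_) (ℕ.*-comm q q′)) (sym (^-assocʳ x q′ q))))
      (trans (sym (^ℤ-assocʳ d p q′)) (trans (cong (d ^ℤ_) eq) (^ℤ-assocʳ d p′ q)))
      (^-mono (0≤^ 0≤x q) (0≤^ℤ d p) h q′))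

  -- Raising the two comparisons to the powers s and q and multiplying them gives the comparison for
  -- the unreduced fraction (ps + rq)/(qs); `rescale` passes from it to the normal form of `a + b`.
  exponent-+ : ∀ d .{{_ : NonZero d}} a b {x y} → 0ℚ ℚ.≤ x → 0ℚ ℚ.≤ y →
               ComparesTo d a x → ComparesTo d b y → ComparesTo d (a ℚ.+ b) (x ℚ.* y)
  exponent-+ d a@(ℚ.mkℚ p q-1 _) b@(ℚ.mkℚ r s-1 _) {x} {y} 0≤x 0≤y hx hy =
    rescale d (p ℤ.* + s ℤ.+ r ℤ.* + q) (q ℕ.* s) (ℚ.↥ (a ℚ.+ b)) (ℚ.↧ₙ (a ℚ.+ b)) (0≤* 0≤x 0≤y)
      (sym (subst₂ (λ i j → i ℤ.* + (q ℕ.* s) ≡ (p ℤ.* + s ℤ.+ r ℤ.* + q) ℤ.* j)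
        (ℚ.↥ᵘ-toℚᵘ (a ℚ.+ b)) (ℚ.↧ᵘ-toℚᵘ (a ℚ.+ b)) (ℚᵘ.drop-*≡* (ℚ.toℚᵘ-homo-+ a b))))
      (subst₂ _≲_
        (trans (cong₂ ℚ._*_ (^-assocʳ x q s)
                 (trans (^-assocʳ y s q) (cong (y ^ℕ_) (ℕ.*-comm s q))))
               (sym (^-distrib-* x y (q ℕ.* s))))
        (sym (trans (^ℤ-homo-+ d (p ℤ.* + s) (r ℤ.* + q)) (cong₂ ℚ._*_ (^ℤ-assocʳ d p s) (^ℤ-assocʳ d r q))))
        (*-mono-≲ (0≤^ (0≤^ 0≤x q) s) (0≤^ (0≤^ℤ d p) s) (0≤^ (0≤^ 0≤y s) q) (0≤^ (0≤^ℤ d r) q)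
          (^-mono (0≤^ 0≤x q) (0≤^ℤ d p) hx s)
          (^-mono (0≤^ 0≤y s) (0≤^ℤ d r) hy q)))
    where
    q = suc q-1
    s = suc s-1

  base-* : ∀ d e .{{_ : NonZero d}} .{{_ : NonZero e}} .{{_ : NonZero (d ℕ.* e)}} a {x y} →
           0ℚ ℚ.≤ x → 0ℚ ℚ.≤ y → ComparesTo d a x → ComparesTo e a y → ComparesTo (d ℕ.* e) a (x ℚ.* y)
  base-* d e a {x} {y} 0≤x 0≤y hx hy = subst₂ _≲_
    (sym (^-distrib-* x y (ℚ.↧ₙ a))) (sym (^ℤ-distrib-* d e (ℚ.↥ a)))
    (*-mono-≲ (0≤^ 0≤x (ℚ.↧ₙ a)) (0≤^ℤ d (ℚ.↥ a)) (0≤^ 0≤y (ℚ.↧ₙ a)) (0≤^ℤ e (ℚ.↥ a)) hx hy)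

module Below = RationalPowerComparison ℚ._≤_
  (λ 0≤x _ → ^-mono-≤ 0≤x)
  (λ _ 0≤y → ^-cancel-≤ 0≤y)
  (λ 0≤x _ _ 0≤w → *-mono 0≤x 0≤w)

module Above = RationalPowerComparison (flip ℚ._≤_)
  (λ _ 0≤y → ^-mono-≤ 0≤y)
  (λ 0≤x _ → ^-cancel-≤ 0≤x)
  (λ 0≤x 0≤y 0≤z 0≤w → *-mono 0≤y 0≤z)

-- The ordered ring of Cauchy reals

≤⊔ˡ : ∀ {m n o} → m ℕ.⊔ n ℕ.≤ o → m ℕ.≤ o
≤⊔ˡ = ℕ.m⊔n≤o⇒m≤o _ _

≤⊔ʳ : ∀ m {n o} → m ℕ.⊔ n ℕ.≤ o → n ℕ.≤ o
≤⊔ʳ m = ℕ.m⊔n≤o⇒n≤o m _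

½pos : ∀ {ε} → 0ℚ ℚ.< ε → 0ℚ ℚ.< ½ ℚ.* ε
½pos = 0<* 0<½

pointwise-≈ : ∀ {x y} → (∀ n → seq x n ≡ seq y n) → x ≈ y
pointwise-≈ {x} {y} x≡y = mk≈ λ ε 0<ε → 0 , λ n _ → subst (ℚ._≤ ε)
  (sym (trans (cong (λ z → ∣ z ℚ.- seq y n ∣) (x≡y n)) (cong ∣_∣ (ℚ.+-inverseʳ (seq y n))))) (ℚ.<⇒≤ 0<ε)

eventually-≤ : ∀ {x y} N → (∀ n → N ℕ.≤ n → seq x n ℚ.≤ seq y n) → x ≤ y
eventually-≤ {x} {y} N x≤y = mk≤ λ ε 0<ε → N , λ n N≤n →
  subst (ℚ._≤ seq y n ℚ.+ ε) (ℚ.+-identityʳ (seq x n)) (ℚ.+-mono-≤ (x≤y n N≤n) (ℚ.<⇒≤ 0<ε))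

≈⇒≤ : ∀ {x y} → x ≈ y → x ≤ y
≈⇒≤ x≈y = mk≤ λ ε 0<ε → let N , h = close x≈y ε 0<ε in N , λ n N≤n → ∣-∣⇒≤ (h n N≤n)

≈-sym : ∀ {x y} → x ≈ y → y ≈ x
≈-sym {x} {y} x≈y = mk≈ λ ε 0<ε → let N , h = close x≈y ε 0<ε in
  N , λ n N≤n → subst (ℚ._≤ ε) (∣-∣-comm (seq x n) (seq y n)) (h n N≤n)

≤-antisym : ∀ {x y} → x ≤ y → y ≤ x → x ≈ y
≤-antisym x≤y y≤x = mk≈ λ ε 0<ε →
  let M , h = bound x≤y ε 0<ε
      N , k = bound y≤x ε 0<ε
  in M ℕ.⊔ N , λ n N≤n → ∣-∣≤ (h n (≤⊔ˡ N≤n)) (k n (≤⊔ʳ M N≤n))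

≤-trans : ∀ {x y z} → x ≤ y → y ≤ z → x ≤ z
≤-trans {x} {y} {z} x≤y y≤z = mk≤ λ ε 0<ε →
  let M , h = bound x≤y (½ ℚ.* ε) (½pos 0<ε)
      N , k = bound y≤z (½ ℚ.* ε) (½pos 0<ε)
  in M ℕ.⊔ N , λ n N≤n → ℚ.≤-trans (h n (≤⊔ˡ N≤n))
       (ℚ.≤-trans (ℚ.+-monoˡ-≤ (½ ℚ.* ε) (k n (≤⊔ʳ M N≤n)))
         (ℚ.≤-reflexive (trans (ℚ.+-assoc (seq z n) (½ ℚ.* ε) (½ ℚ.* ε)) (cong (λ e → seq z n ℚ.+ e) (half+half ε)))))

≈-refl : ∀ {x} → x ≈ x
≈-refl = pointwise-≈ λ _ → refl

≈-trans : ∀ {x y z} → x ≈ y → y ≈ z → x ≈ z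
≈-trans x≈y y≈z = ≤-antisym (≤-trans (≈⇒≤ x≈y) (≈⇒≤ y≈z)) (≤-trans (≈⇒≤ (≈-sym y≈z)) (≈⇒≤ (≈-sym x≈y)))

≤-poset : Poset _ _ _
≤-poset = record
  { _≈_ = _≈_ ; _≤_ = _≤_
  ; isPartialOrder = record
    { isPreorder = record
      { isEquivalence = record { refl = ≈-refl ; sym = ≈-sym ; trans = ≈-trans }
      ; reflexive = ≈⇒≤
      ; trans = ≤-trans }
    ; antisym = ≤-antisym } }

module ≤-Reasoning = Relation.Binary.Reasoning.PartialOrder ≤-poset

+-mono-≤ : ∀ {x y z w} → x ≤ y → z ≤ w → x + z ≤ y + w
+-mono-≤ {x} {y} {z} {w} x≤y z≤w = mk≤ λ ε 0<ε →
  let M , h = bound x≤y (½ ℚ.* ε) (½pos 0<ε)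
      N , k = bound z≤w (½ ℚ.* ε) (½pos 0<ε)
  in M ℕ.⊔ N , λ n N≤n → ℚ.≤-trans (ℚ.+-mono-≤ (h n (≤⊔ˡ N≤n)) (k n (≤⊔ʳ M N≤n)))
       (ℚ.≤-reflexive (trans
         (solve 3 (λ y w e → (y :+ e) :+ (w :+ e) := (y :+ w) :+ (e :+ e)) refl (seq y n) (seq w n) (½ ℚ.* ε))
         (cong (λ e → seq y n ℚ.+ seq w n ℚ.+ e) (half+half ε))))

+-cong : ∀ {x y z w} → x ≈ y → z ≈ w → x + z ≈ y + w
+-cong {x} {y} {z} {w} x≈y z≈w = ≤-antisym
  (+-mono-≤ {x} {y} {z} {w} (≈⇒≤ x≈y) (≈⇒≤ z≈w))
  (+-mono-≤ {y} {x} {w} {z} (≈⇒≤ (≈-sym x≈y)) (≈⇒≤ (≈-sym z≈w)))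

+-cancelˡ-≤ : ∀ x {y z} → x + y ≤ x + z → y ≤ z
+-cancelˡ-≤ x {y} {z} h = mk≤ λ ε 0<ε → let N , k = bound h ε 0<ε in N , λ n N≤n → subst₂ ℚ._≤_
  (solve 2 (λ x y → (:- x) :+ (x :+ y) := y) refl (seq x n) (seq y n))
  (solve 3 (λ x z e → (:- x) :+ ((x :+ z) :+ e) := z :+ e) refl (seq x n) (seq z n) ε)
  (ℚ.+-monoʳ-≤ (ℚ.- seq x n) (k n N≤n))

-- From x + w ≤ y + w ≈ x + z, cancelling x leaves w ≤ z. This replaces the classical case split on
-- strict inequality.
+-squeezeˡ : ∀ {x y z w} → x ≤ y → z ≤ w → x + z ≈ y + w → z ≈ w
+-squeezeˡ {x} {y} {z} {w} x≤y z≤w eq = ≤-antisym z≤w (+-cancelˡ-≤ x {w} {z}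
  (≤-trans (+-mono-≤ {x} {y} {w} {w} x≤y (≈⇒≤ ≈-refl)) (≈⇒≤ (≈-sym eq))))

+-comm : ∀ x y → x + y ≈ y + x
+-comm x y = pointwise-≈ λ n → ℚ.+-comm (seq x n) (seq y n)

+-squeezeʳ : ∀ {x y z w} → x ≤ y → z ≤ w → x + z ≈ y + w → x ≈ y
+-squeezeʳ {x} {y} {z} {w} x≤y z≤w eq =
  +-squeezeˡ {z} {w} {x} {y} z≤w x≤y (≈-trans (+-comm z x) (≈-trans eq (+-comm y w)))

*-comm : ∀ x y → x * y ≈ y * x
*-comm x y = pointwise-≈ λ n → ℚ.*-comm (seq x n) (seq y n)

*-assoc : ∀ x y z → x * y * z ≈ x * (y * z)
*-assoc x y z = pointwise-≈ λ n → ℚ.*-assoc (seq x n) (seq y n) (seq z n)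

*-congʳ : ∀ {x y} z → x ≈ y → x * z ≈ y * z
*-congʳ {x} {y} z x≈y = mk≈ λ ε 0<ε →
  let B , M , z≤B = eventually-bounded z
      p , small   = archimedean B ε 0<ε
      N , h       = close x≈y (1/suc p) (0<1/suc p)
  in M ℕ.⊔ N , λ n N≤n → ℚ.≤-trans (ℚ.≤-reflexive (trans
       (cong ∣_∣ (solve 3 (λ x y z → x :* z :+ (:- (y :* z)) := z :* (x :+ (:- y))) refl (seq x n) (seq y n) (seq z n)))
       (ℚ.∣p*q∣≡∣p∣*∣q∣ (seq z n) (seq x n ℚ.- seq y n))))
     (ℚ.≤-trans (*-mono (ℚ.0≤∣p∣ (seq z n)) (ℚ.<⇒≤ (0<1/suc p)) (z≤B n (≤⊔ˡ N≤n)) (h n (≤⊔ʳ M N≤n))) small)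

*-congˡ : ∀ {x y} z → x ≈ y → z * x ≈ z * y
*-congˡ {x} {y} z x≈y = ≈-trans (*-comm z x) (≈-trans (*-congʳ {x} {y} z x≈y) (*-comm y z))

*-cong : ∀ {x y z w} → x ≈ y → z ≈ w → x * z ≈ y * w
*-cong {x} {y} {z} {w} x≈y z≈w = ≈-trans (*-congʳ {x} {y} z x≈y) (*-congˡ {z} {w} y z≈w)

gap≤ : ∀ {z} (0<z : 0ℝ < z) n → from 0<z ℕ.≤ n → gap 0<z ℚ.≤ seq z n
gap≤ {z} 0<z n N≤n = subst (ℚ._≤ seq z n) (ℚ.+-identityˡ (gap 0<z)) (separated 0<z n N≤n)

*-monoʳ-≤ : ∀ {x y} z → 0ℝ < z → x ≤ y → x * z ≤ y * z
*-monoʳ-≤ {x} {y} z 0<z x≤y = mk≤ λ ε 0<ε →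
  let B , M , z≤B = eventually-bounded z
      p , small   = archimedean B ε 0<ε
      N , h       = bound x≤y (1/suc p) (0<1/suc p)
  in (from 0<z ℕ.⊔ M) ℕ.⊔ N , λ n N≤n → ℚ.≤-trans
       (*-monoʳ (seq z n) (ℚ.≤-trans (ℚ.<⇒≤ (gap>0 0<z)) (gap≤ 0<z n (≤⊔ˡ (≤⊔ˡ N≤n)))) (h n (≤⊔ʳ (from 0<z ℕ.⊔ M) N≤n)))
       (ℚ.≤-trans (ℚ.≤-reflexive (ℚ.*-distribʳ-+ (seq z n) (seq y n) (1/suc p)))
         (ℚ.+-monoʳ-≤ (seq y n ℚ.* seq z n) (ℚ.≤-trans (ℚ.≤-reflexive (ℚ.*-comm (1/suc p) (seq z n)))
           (ℚ.≤-trans (*-monoʳ (1/suc p) (ℚ.<⇒≤ (0<1/suc p)) (ℚ.≤-trans (≤∣∣ (seq z n)) (z≤B n (≤⊔ʳ (from 0<z) (≤⊔ˡ N≤n)))))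
             small))))

*-monoˡ-≤ : ∀ {x y} z → 0ℝ < z → x ≤ y → z * x ≤ z * y
*-monoˡ-≤ {x} {y} z 0<z x≤y = ≤-trans (≈⇒≤ (*-comm z x)) (≤-trans (*-monoʳ-≤ {x} {y} z 0<z x≤y) (≈⇒≤ (*-comm y z)))

*-cancelʳ-≤ : ∀ {x y} z → 0ℝ < z → x * z ≤ y * z → x ≤ y
*-cancelʳ-≤ {x} {y} z 0<z xz≤yz = mk≤ λ ε 0<ε →
  let c     = gap 0<z
      -- The tolerance is scaled by the gap c: since c ≤ z, the error ε c is at most ε z, and z then
      -- cancels from every term.
      N , h = bound xz≤yz (ε ℚ.* c) (0<* 0<ε (gap>0 0<z))
  in from 0<z ℕ.⊔ N , λ n N≤n →
     let c≤z = gap≤ 0<z n (≤⊔ˡ N≤n)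
     in ℚ.*-cancelʳ-≤-pos (seq z n) {{ℚ.positive (ℚ.<-≤-trans (gap>0 0<z) c≤z)}}
          (ℚ.≤-trans (h n (≤⊔ʳ (from 0<z) N≤n))
            (ℚ.≤-trans (ℚ.+-monoʳ-≤ (seq y n ℚ.* seq z n) (*-monoˡ ε (ℚ.<⇒≤ 0<ε) c≤z))
              (ℚ.≤-reflexive (sym (ℚ.*-distribʳ-+ (seq z n) (seq y n) ε)))))

*-cancelʳ : ∀ {x y} z → 0ℝ < z → x * z ≈ y * z → x ≈ y
*-cancelʳ {x} {y} z 0<z eq = ≤-antisym (*-cancelʳ-≤ {x} {y} z 0<z (≈⇒≤ eq)) (*-cancelʳ-≤ {y} {x} z 0<z (≈⇒≤ (≈-sym eq)))

+-positive : ∀ {x y} → 0ℝ < x → 0ℝ < y → 0ℝ < x + y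
+-positive 0<x 0<y = mk< (gap 0<x ℚ.+ gap 0<y) (ℚ.+-mono-< (gap>0 0<x) (gap>0 0<y)) (from 0<x ℕ.⊔ from 0<y) λ n N≤n →
  ℚ.≤-trans (ℚ.≤-reflexive (ℚ.+-identityˡ (gap 0<x ℚ.+ gap 0<y)))
    (ℚ.+-mono-≤ (gap≤ 0<x n (≤⊔ˡ N≤n)) (gap≤ 0<y n (≤⊔ʳ (from 0<x) N≤n)))

-- `recip` is an inverse only at positive arguments, and the terms of `y` are known to be positive
-- only from the index of its gap on; hence equality of terms holds eventually, not everywhere.
/-*-inverse : ∀ x y {{0<y : 0ℝ < y}} → x / y * y ≈ x
/-*-inverse x y {{0<y}} = ≤-antisym (eventually-≤ (from 0<y) λ n N≤n → ℚ.≤-reflexive (eq n N≤n))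
                                    (eventually-≤ (from 0<y) λ n N≤n → ℚ.≤-reflexive (sym (eq n N≤n)))
  where
  eq : ∀ n → from 0<y ℕ.≤ n → seq (x / y * y) n ≡ seq x n
  eq n N≤n = trans (ℚ.*-assoc (seq x n) _ (seq y n)) (trans (cong (seq x n ℚ.*_)
    (trans (ℚ.*-comm _ (seq y n)) (recip-inverse (ℚ.<-≤-trans (gap>0 0<y) (gap≤ 0<y n N≤n))))) (ℚ.*-identityʳ (seq x n)))

-- Distinct naturals differ by at least 1, so a single tolerance of ½ decides the order.
fromℕ-cancel-≤ : ∀ {m n} → fromℚ (fromℕ m) ≤ fromℚ (fromℕ n) → m ℕ.≤ n
fromℕ-cancel-≤ {m} {n} h with m ℕ.≤? n
... | yes m≤n = m≤n
... | no  m≰n = contradiction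
  (ℚ.<-≤-trans (ℚ.+-monoʳ-< (fromℕ n) ½<1) (ℚ.≤-trans
    (subst (ℚ._≤ fromℕ m) (trans (fromℕ-suc n) (ℚ.+-comm 1ℚ (fromℕ n))) (fromℕ-mono (ℕ.≰⇒> m≰n)))
    (proj₂ (bound h ½ 0<½) _ ℕ.≤-refl)))
  (ℚ.<-irrefl refl)
  where
  ½<1 : ½ ℚ.< 1ℚ
  ½<1 = ℚ.*<* (ℤ.+<+ (ℕ.s≤s (ℕ.s≤s ℕ.z≤n)))

-- Real powers

-- The terms of d ^ a are truncated from below by less than 1/(n+1), so those of d ^ a + vanishing
-- lie above d^a.
vanishing : ℝ
vanishing = mkℝ 1/suc λ ε 0<ε →
  let N , h = archimedean 1ℚ ε 0<ε
      small : ∀ m n → N ℕ.≤ m → 1/suc m ℚ.≤ 1/suc n ℚ.+ ε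
      small m n N≤m = ℚ.≤-trans (1/suc-antimono N≤m) (ℚ.≤-trans (ℚ.≤-reflexive (sym (ℚ.*-identityˡ (1/suc N))))
        (ℚ.≤-trans h (ℚ.≤-trans (ℚ.≤-reflexive (sym (ℚ.+-identityˡ ε))) (ℚ.+-monoˡ-≤ ε (ℚ.<⇒≤ (0<1/suc n))))))
  in N , λ m n N≤m N≤n → ∣-∣≤ (small m n N≤m) (small n m N≤n)

+-vanishing : ∀ x → x + vanishing ≈ x
+-vanishing x = ≤-antisym
  (mk≤ λ ε 0<ε → let N , h = archimedean 1ℚ ε 0<ε in N , λ n N≤n →
    ℚ.+-monoʳ-≤ (seq x n) (ℚ.≤-trans (1/suc-antimono N≤n) (ℚ.≤-trans (ℚ.≤-reflexive (sym (ℚ.*-identityˡ (1/suc N)))) h)))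
  (eventually-≤ 0 λ n _ → ℚ.≤-trans (ℚ.≤-reflexive (sym (ℚ.+-identityʳ (seq x n))))
    (ℚ.+-monoʳ-≤ (seq x n) (ℚ.<⇒≤ (0<1/suc n))))

0≤power : ∀ d .{{_ : NonZero d}} a n → 0ℚ ℚ.≤ seq (d ^ a) n
0≤power (suc d) a n = 0≤approxPower d n (seq a n)

0≤power⁺ : ∀ d .{{_ : NonZero d}} a n → 0ℚ ℚ.≤ seq (d ^ a + vanishing) n
0≤power⁺ d a n = 0≤+ (0≤power d a n) (ℚ.<⇒≤ (0<1/suc n))

power-below : ∀ d .{{_ : NonZero d}} a n → Below.ComparesTo d (seq a n) (seq (d ^ a) n)
power-below (suc d) a n = proj₁ (approxPower-correct d n (seq a n))

power-above : ∀ d .{{_ : NonZero d}} a n → Above.ComparesTo d (seq a n) (seq (d ^ a + vanishing) n)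
power-above (suc d) a n = ℚ.<⇒≤ (proj₂ (approxPower-correct d n (seq a n)))

-- Comparing q-th powers puts x below the enlarged terms, those of `d ^ a + vanishing`; the
-- enlargement disappears in the limit.
below⇒≤ : ∀ d .{{_ : NonZero d}} a {x} N → (∀ n → N ℕ.≤ n → Below.ComparesTo d (seq a n) (seq x n)) → x ≤ d ^ a
below⇒≤ d a N h = ≤-trans (eventually-≤ N λ n N≤n → ^-cancel-≤ (0≤power⁺ d a n) (ℚ.↧ₙ (seq a n))
  (ℚ.≤-trans (h n N≤n) (power-above d a n))) (≈⇒≤ (+-vanishing (d ^ a)))

-- The truncated terms already lie below the true power, so no slack has to be added in this
-- direction.
above⇒≥ : ∀ d .{{_ : NonZero d}} a {x} → (∀ n → 0ℚ ℚ.≤ seq x n) → (∀ n → Above.ComparesTo d (seq a n) (seq x n)) → d ^ a ≤ x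
above⇒≥ d a 0≤x h = eventually-≤ 0 λ n _ → ^-cancel-≤ (0≤x n) (ℚ.↧ₙ (seq a n)) (ℚ.≤-trans (power-below d a n) (h n))

-- Products of truncated terms are lower approximations for the exponent `a + b`, products of
-- enlarged terms are upper ones, and both products have the same limit.
^-homo-+ : ∀ d .{{_ : NonZero d}} a b → d ^ (a + b) ≈ d ^ a * d ^ b
^-homo-+ d a b = ≤-antisym
  (≤-trans
    (above⇒≥ d (a + b) {(d ^ a + vanishing) * (d ^ b + vanishing)} (λ n → 0≤* (0≤power⁺ d a n) (0≤power⁺ d b n))
      λ n → Above.exponent-+ d (seq a n) (seq b n) (0≤power⁺ d a n) (0≤power⁺ d b n) (power-above d a n) (power-above d b n))
    (≈⇒≤ (*-cong {d ^ a + vanishing} {d ^ a} {d ^ b + vanishing} {d ^ b} (+-vanishing (d ^ a)) (+-vanishing (d ^ b)))))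
  (below⇒≤ d (a + b) {d ^ a * d ^ b} 0 λ n _ →
    Below.exponent-+ d (seq a n) (seq b n) (0≤power d a n) (0≤power d b n) (power-below d a n) (power-below d b n))

^-distribʳ-* : ∀ d e .{{_ : NonZero d}} .{{_ : NonZero e}} .{{_ : NonZero (d ℕ.* e)}} a → (d ℕ.* e) ^ a ≈ d ^ a * e ^ a
^-distribʳ-* d e a = ≤-antisym
  (≤-trans
    (above⇒≥ (d ℕ.* e) a {(d ^ a + vanishing) * (e ^ a + vanishing)} (λ n → 0≤* (0≤power⁺ d a n) (0≤power⁺ e a n))
      λ n → Above.base-* d e (seq a n) (0≤power⁺ d a n) (0≤power⁺ e a n) (power-above d a n) (power-above e a n))
    (≈⇒≤ (*-cong {d ^ a + vanishing} {d ^ a} {e ^ a + vanishing} {e ^ a} (+-vanishing (d ^ a)) (+-vanishing (e ^ a)))))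
  (below⇒≤ (d ℕ.* e) a {d ^ a * e ^ a} 0 λ n _ →
    Below.base-* d e (seq a n) (0≤power d a n) (0≤power e a n) (power-below d a n) (power-below e a n))

^-congʳ : ∀ d .{{_ : NonZero d}} a b → (∀ n → seq a n ≡ seq b n) → d ^ a ≈ d ^ b
^-congʳ d a b a≡b = pointwise-≈ λ n → cong (approxPower n d) (a≡b n)

^-congˡ : ∀ {d e} .{{_ : NonZero d}} .{{_ : NonZero e}} a → d ≡ e → d ^ a ≈ e ^ a
^-congˡ a refl = ≈-refl

^-zeroʳ : ∀ d .{{_ : NonZero d}} → d ^ 0ℝ ≈ 1ℝ
^-zeroʳ d = ≤-antisym (above⇒≥ d 0ℝ {1ℝ} (λ _ → 0≤1) λ _ → ℚ.≤-refl) (below⇒≤ d 0ℝ {1ℝ} 0 λ _ _ → ℚ.≤-refl)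

^-identityʳ : ∀ d .{{_ : NonZero d}} → d ^ 1ℝ ≈ fromℚ (fromℕ d)
^-identityʳ d = ≤-antisym (above⇒≥ d 1ℝ {fromℚ (fromℕ d)} (λ _ → 0≤/suc d 0) λ _ → ℚ.≤-refl) (below⇒≤ d 1ℝ {fromℚ (fromℕ d)} 0 λ _ _ → ℚ.≤-refl)

^-inverse : ∀ d .{{_ : NonZero d}} a → d ^ (- a) * d ^ a ≈ 1ℝ
^-inverse d a = ≈-trans (≈-sym (^-homo-+ d (- a) a)) (≈-trans (^-congʳ d (- a + a) 0ℝ λ n → ℚ.+-inverseˡ (seq a n)) (^-zeroʳ d))

-- Monotonicity in the base is checked term by term and depends on the sign of each rational
-- exponent. Unlike `0ℝ < a`, this condition also admits a multiple of the exponent minus 1, which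
-- is not known to stay away from zero.
EventuallyNonNegative : ℝ → Set
EventuallyNonNegative a = ∃[ N ] ∀ n → N ℕ.≤ n → 0ℚ ℚ.≤ seq a n

positive⇒nonNegative : ∀ {a} → 0ℝ < a → EventuallyNonNegative a
positive⇒nonNegative 0<a = from 0<a , λ n N≤n → ℚ.≤-trans (ℚ.<⇒≤ (gap>0 0<a)) (gap≤ 0<a n N≤n)

^-monoˡ-≤ : ∀ {d e} .{{_ : NonZero d}} .{{_ : NonZero e}} a → EventuallyNonNegative a → d ℕ.≤ e → d ^ a ≤ e ^ a
^-monoˡ-≤ {d} {e} a (N , 0≤a) d≤e = below⇒≤ e a {d ^ a} N λ n N≤n →
  ℚ.≤-trans (power-below d a n) (^ℤ-monoˡ (seq a n) (0≤a n N≤n))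
  where
  ^ℤ-monoˡ : ∀ q → 0ℚ ℚ.≤ q → d ^ℤ ℚ.↥ q ℚ.≤ e ^ℤ ℚ.↥ q
  ^ℤ-monoˡ (ℚ.mkℚ (+ p) _ _)    0≤q = ^-mono-≤ (0≤/suc d 0) (fromℕ-mono d≤e) p
  ^ℤ-monoˡ (ℚ.mkℚ -[1+ _ ] _ _) 0≤q with () ← ℤ.NonNegative.nonNeg (ℚ.nonNegative 0≤q)

infixr 7 _·_

-- Repeated addition instead of a product with a constant, so that `^-homo-+` applies along the
-- recursion and `d ^ (m · a)` acts as the m-th power of `d ^ a`.
_·_ : ℕ → ℝ → ℝ
zero  · a = 0ℝ
suc m · a = a + m · a

seq-· : ∀ m a n → seq (m · a) n ≡ fromℕ m ℚ.* seq a n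
seq-· zero    a n = sym (trans (cong (ℚ._* seq a n) (0/suc≡0 0)) (ℚ.*-zeroˡ (seq a n)))
seq-· (suc m) a n = begin
  seq a n ℚ.+ seq (m · a) n           ≡⟨ cong (λ x → seq a n ℚ.+ x) (seq-· m a n) ⟩
  seq a n ℚ.+ fromℕ m ℚ.* seq a n     ≡⟨ solve 2 (λ m a → a :+ m :* a := (con 1ℚ :+ m) :* a) refl (fromℕ m) (seq a n) ⟩
  (1ℚ ℚ.+ fromℕ m) ℚ.* seq a n        ≡⟨ cong (ℚ._* seq a n) (sym (fromℕ-suc m)) ⟩
  fromℕ (suc m) ℚ.* seq a n           ∎
  where open ≡-Reasoning

^-·-mono-≤ : ∀ d e .{{_ : NonZero d}} .{{_ : NonZero e}} a → d ^ a ≤ e ^ a → ∀ m → d ^ (m · a) ≤ e ^ (m · a)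
^-·-mono-≤ d e a h zero    = ≈⇒≤ (≈-trans (^-zeroʳ d) (≈-sym (^-zeroʳ e)))
^-·-mono-≤ d e a h (suc m) = begin
  d ^ (a + m · a)         ≈⟨ ^-homo-+ d a (m · a) ⟩
  d ^ a * d ^ (m · a)     ≤⟨ *-monoʳ-≤ {d ^ a} {e ^ a} (d ^ (m · a)) (^-positive d (m · a)) h ⟩
  e ^ a * d ^ (m · a)     ≤⟨ *-monoˡ-≤ {d ^ (m · a)} {e ^ (m · a)} (e ^ a) (^-positive e a) (^-·-mono-≤ d e a h m) ⟩
  e ^ a * e ^ (m · a)     ≈⟨ ^-homo-+ e a (m · a) ⟨
  e ^ (a + m · a)         ∎
  where open ≤-Reasoning

-- The Archimedean property gives 1/(m+1) below the gap of `a`, so m + 1 copies of `a` reach 1 as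
-- soon as the gap is in force.
1≤· : ∀ {a} → 0ℝ < a → ∃[ m ] ∃[ N ] ∀ n → N ℕ.≤ n → 1ℚ ℚ.≤ seq (m · a) n
1≤· {a} 0<a = suc m , from 0<a , λ n N≤n → begin
  1ℚ                              ≡⟨ trans (sym (E*D m)) (ℚ.*-comm (1/suc m) (fromℕ (suc m))) ⟩
  fromℕ (suc m) ℚ.* 1/suc m       ≤⟨ *-monoˡ (fromℕ (suc m)) (0≤/suc (suc m) 0) (ℚ.≤-trans
                                      (ℚ.≤-reflexive (sym (ℚ.*-identityˡ (1/suc m))))
                                      (ℚ.≤-trans (proj₂ small) (gap≤ 0<a n N≤n))) ⟩
  fromℕ (suc m) ℚ.* seq a n       ≡⟨ sym (seq-· (suc m) a n) ⟩
  seq (suc m · a) n               ∎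
  where
  open ℚ.≤-Reasoning
  small = archimedean 1ℚ (gap 0<a) (gap>0 0<a)
  m = proj₁ small

^-1+ : ∀ d .{{_ : NonZero d}} a → d ^ (1ℝ + a) ≈ fromℚ (fromℕ d) * d ^ a
^-1+ d a = ≈-trans (^-homo-+ d 1ℝ a) (*-congʳ {d ^ 1ℝ} {fromℚ (fromℕ d)} (d ^ a) (^-identityʳ d))

fromℕ-positive : ∀ d .{{_ : NonZero d}} → 0ℝ < fromℚ (fromℕ d)
fromℕ-positive (suc d) = mk< (fromℕ (suc d)) (0</suc d 0) 0 λ _ _ → ℚ.≤-reflexive (ℚ.+-identityˡ (fromℕ (suc d)))

-- The summand 1 splits off the factors `e` and `d`. Once both sides carry `e ^ a`, cancelling it
-- leaves an inequality between naturals.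
^-cancelˡ-≤-1+ : ∀ d e .{{_ : NonZero d}} .{{_ : NonZero e}} a → EventuallyNonNegative a →
                 d ℕ.≤ e → e ^ (1ℝ + a) ≤ d ^ (1ℝ + a) → e ℕ.≤ d
^-cancelˡ-≤-1+ d e a 0≤a d≤e h = fromℕ-cancel-≤ (*-cancelʳ-≤ {fromℚ (fromℕ e)} {fromℚ (fromℕ d)} (e ^ a) (^-positive e a) (begin
  fromℚ (fromℕ e) * e ^ a   ≈⟨ ^-1+ e a ⟨
  e ^ (1ℝ + a)              ≤⟨ h ⟩
  d ^ (1ℝ + a)              ≈⟨ ^-1+ d a ⟩
  fromℚ (fromℕ d) * d ^ a   ≤⟨ *-monoˡ-≤ {d ^ a} {e ^ a} (fromℚ (fromℕ d)) (fromℕ-positive d) (^-monoˡ-≤ a 0≤a d≤e) ⟩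
  fromℚ (fromℕ d) * e ^ a   ∎))
  where open ≤-Reasoning

^-cancelˡ-≤-1≤ : ∀ d e .{{_ : NonZero d}} .{{_ : NonZero e}} a N → (∀ n → N ℕ.≤ n → 1ℚ ℚ.≤ seq a n) →
                 d ℕ.≤ e → e ^ a ≤ d ^ a → e ℕ.≤ d
^-cancelˡ-≤-1≤ d e a N 1≤a d≤e h = ^-cancelˡ-≤-1+ d e (a + - 1ℝ)
  (N , λ n N≤n → subst (ℚ._≤ seq a n ℚ.+ ℚ.- 1ℚ) (ℚ.+-inverseʳ 1ℚ) (ℚ.+-monoˡ-≤ (ℚ.- 1ℚ) (1≤a n N≤n))) d≤e
  (≤-trans (≈⇒≤ (≈-sym (shift e))) (≤-trans h (≈⇒≤ (shift d))))
  where
  shift : ∀ b .{{_ : NonZero b}} → b ^ a ≈ b ^ (1ℝ + (a + - 1ℝ))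
  shift b = ^-congʳ b a (1ℝ + (a + - 1ℝ)) λ n →
    solve 1 (λ x → x := con 1ℚ :+ (x :+ (:- con 1ℚ))) refl (seq a n)

-- A multiple of a is 1 + c with c ≥ 0, and e e^c ≤ d d^c ≤ d e^c when d ≤ e.
^-cancelˡ-≤ : ∀ {d e} .{{_ : NonZero d}} .{{_ : NonZero e}} a → 0ℝ < a → e ^ a ≤ d ^ a → e ℕ.≤ d
^-cancelˡ-≤ {d} {e} a 0<a eᵃ≤dᵃ with ℕ.≤-total e d
... | inj₁ e≤d = e≤d
... | inj₂ d≤e = let m , N , 1≤ = 1≤· 0<a in ^-cancelˡ-≤-1≤ d e (m · a) N 1≤ d≤e (^-·-mono-≤ e d a eᵃ≤dᵃ m)

^-injectiveˡ : ∀ {d e} .{{_ : NonZero d}} .{{_ : NonZero e}} a → 0ℝ < a → d ^ a ≈ e ^ a → d ≡ e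
^-injectiveˡ a 0<a eq = ℕ.≤-antisym (^-cancelˡ-≤ a 0<a (≈⇒≤ eq)) (^-cancelˡ-≤ a 0<a (≈⇒≤ (≈-sym eq)))

-- Multiplying by the positive `d ^ a` reduces the claim to monotonicity for a nonnegative exponent,
-- as both inverses yield 1.
^-antimonoˡ-≤ : ∀ {d e} .{{_ : NonZero d}} .{{_ : NonZero e}} a → EventuallyNonNegative a → d ℕ.≤ e → e ^ (- a) ≤ d ^ (- a)
^-antimonoˡ-≤ {d} {e} a 0≤a d≤e = *-cancelʳ-≤ {e ^ (- a)} {d ^ (- a)} (d ^ a) (^-positive d a) (begin
  e ^ (- a) * d ^ a           ≤⟨ *-monoˡ-≤ {d ^ a} {e ^ a} (e ^ (- a)) (^-positive e (- a)) (^-monoˡ-≤ a 0≤a d≤e) ⟩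
  e ^ (- a) * e ^ a           ≈⟨ ^-inverse e a ⟩
  1ℝ                          ≈⟨ ^-inverse d a ⟨
  d ^ (- a) * d ^ a           ∎)
  where open ≤-Reasoning

^-neg-injectiveˡ : ∀ {d e} .{{_ : NonZero d}} .{{_ : NonZero e}} a → 0ℝ < a → d ^ (- a) ≈ e ^ (- a) → d ≡ e
^-neg-injectiveˡ {d} {e} a 0<a eq = ^-injectiveˡ a 0<a (*-cancelʳ {d ^ a} {e ^ a} (d ^ (- a)) (^-positive d (- a)) (begin-equality
  d ^ a * d ^ (- a)           ≈⟨ *-comm (d ^ a) (d ^ (- a)) ⟩
  d ^ (- a) * d ^ a           ≈⟨ ^-inverse d a ⟩
  1ℝ                          ≈⟨ ^-inverse e a ⟨
  e ^ (- a) * e ^ a           ≈⟨ *-comm (e ^ (- a)) (e ^ a) ⟩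
  e ^ a * e ^ (- a)           ≈⟨ *-congˡ {d ^ (- a)} {e ^ (- a)} (e ^ a) eq ⟨
  e ^ a * d ^ (- a)           ∎))
  where open ≤-Reasoning

-- Finite sums and graphs

-- Sums of reals are formed term by term along the Cauchy sequences, so the rearrangements of sums
-- are proved over the rationals and transferred at each index.
sumℚ : List A → (A → ℚ) → ℚ
sumℚ xs f = foldr (λ x s → f x ℚ.+ s) 0ℚ xs

sumℚ-cong : ∀ (xs : List A) {f g : A → ℚ} → (∀ x → f x ≡ g x) → sumℚ xs f ≡ sumℚ xs g
sumℚ-cong []       f≗g = refl
sumℚ-cong (x ∷ xs) f≗g = cong₂ ℚ._+_ (f≗g x) (sumℚ-cong xs f≗g)

sumℚ-zero : ∀ (xs : List A) → sumℚ xs (λ _ → 0ℚ) ≡ 0ℚ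
sumℚ-zero []       = refl
sumℚ-zero (x ∷ xs) = trans (ℚ.+-identityˡ _) (sumℚ-zero xs)

sumℚ-+ : ∀ (xs : List A) (f g : A → ℚ) → sumℚ xs (λ x → f x ℚ.+ g x) ≡ sumℚ xs f ℚ.+ sumℚ xs g
sumℚ-+ []       f g = refl
sumℚ-+ (x ∷ xs) f g = trans (cong (λ s → f x ℚ.+ g x ℚ.+ s) (sumℚ-+ xs f g))
  (solve 4 (λ a b c d → (a :+ b) :+ (c :+ d) := (a :+ c) :+ (b :+ d)) refl (f x) (g x) (sumℚ xs f) (sumℚ xs g))

sumℚ-*ˡ : ∀ (xs : List A) c f → c ℚ.* sumℚ xs f ≡ sumℚ xs (λ x → c ℚ.* f x)
sumℚ-*ˡ []       c f = ℚ.*-zeroʳ c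
sumℚ-*ˡ (x ∷ xs) c f = trans (ℚ.*-distribˡ-+ c (f x) (sumℚ xs f)) (cong (λ s → c ℚ.* f x ℚ.+ s) (sumℚ-*ˡ xs c f))

sumℚ-swap : ∀ (xs : List A) (ys : List B) (f : A → B → ℚ) →
            sumℚ xs (λ x → sumℚ ys (f x)) ≡ sumℚ ys (λ y → sumℚ xs (λ x → f x y))
sumℚ-swap []       ys f = sym (sumℚ-zero ys)
sumℚ-swap (x ∷ xs) ys f = trans (cong (λ s → sumℚ ys (f x) ℚ.+ s) (sumℚ-swap xs ys f))
  (sym (sumℚ-+ ys (f x) (λ y → sumℚ xs (λ z → f z y))))

sumℚ-++ : ∀ (xs ys : List A) f → sumℚ (xs ++ ys) f ≡ sumℚ xs f ℚ.+ sumℚ ys f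
sumℚ-++ []       ys f = sym (ℚ.+-identityˡ _)
sumℚ-++ (x ∷ xs) ys f = trans (cong (λ s → f x ℚ.+ s) (sumℚ-++ xs ys f)) (sym (ℚ.+-assoc (f x) (sumℚ xs f) (sumℚ ys f)))

sumℚ-map : ∀ (h : A → B) xs f → sumℚ (map h xs) f ≡ sumℚ xs (f ∘ h)
sumℚ-map h []       f = refl
sumℚ-map h (x ∷ xs) f = cong (λ s → f (h x) ℚ.+ s) (sumℚ-map h xs f)

sumℚ-cartesianProduct : ∀ (xs : List A) (ys : List B) f →
                        sumℚ (cartesianProduct xs ys) f ≡ sumℚ xs (λ x → sumℚ ys (λ y → f (x , y)))
sumℚ-cartesianProduct []       ys f = refl
sumℚ-cartesianProduct (x ∷ xs) ys f = trans (sumℚ-++ (map (x ,_) ys) (cartesianProduct xs ys) f)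
  (cong₂ ℚ._+_ (sumℚ-map (x ,_) ys f) (sumℚ-cartesianProduct xs ys f))

infixr 7 [_]_

-- The Iverson bracket: it turns a sum over a filtered list into an unrestricted sum, whose order of
-- summation can be interchanged.
[_]_ : Bool → ℚ → ℚ
[ b ] q = if b then q else 0ℚ

[]-distrib-+ : ∀ b p q → [ b ] (p ℚ.+ q) ≡ [ b ] p ℚ.+ [ b ] q
[]-distrib-+ false p q = refl
[]-distrib-+ true  p q = refl

sumℚ-filterᵇ : ∀ (p : A → Bool) xs f → sumℚ (filterᵇ p xs) f ≡ sumℚ xs (λ x → [ p x ] f x)
sumℚ-filterᵇ p []       f = refl
sumℚ-filterᵇ p (x ∷ xs) f with p x
... | false = trans (sumℚ-filterᵇ p xs f) (sym (ℚ.+-identityˡ _))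
... | true  = cong (λ s → f x ℚ.+ s) (sumℚ-filterᵇ p xs f)

sumℚ-const : ∀ (xs : List A) q → sumℚ xs (λ _ → q) ≡ fromℕ (length xs) ℚ.* q
sumℚ-const []       q = sym (trans (cong (ℚ._* q) (0/suc≡0 0)) (ℚ.*-zeroˡ q))
sumℚ-const (x ∷ xs) q = trans (cong (λ s → q ℚ.+ s) (sumℚ-const xs q))
  (trans (solve 2 (λ m q → q :+ m :* q := (con 1ℚ :+ m) :* q) refl (fromℕ (length xs)) q)
    (cong (ℚ._* q) (sym (fromℕ-suc (length xs)))))

≮⇒<ᵇ-false : ∀ {m n} → ¬ m ℕ.< n → (m ℕ.<ᵇ n) ≡ false
≮⇒<ᵇ-false {m} {n} m≮n with m ℕ.<ᵇ n in eq
... | false = refl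
... | true  = contradiction (ℕ.<ᵇ⇒< m n (Equivalence.from T-≡ eq)) m≮n

<⇒<ᵇ-true : ∀ {m n} → m ℕ.< n → (m ℕ.<ᵇ n) ≡ true
<⇒<ᵇ-true = Equivalence.to T-≡ ∘ ℕ.<⇒<ᵇ

filterᵇ-witness : ∀ (p : A → Bool) xs → NonZero (length (filterᵇ p xs)) → ∃[ x ] p x ≡ true
filterᵇ-witness p (x ∷ xs) nz with p x in eq
... | false = filterᵇ-witness p xs nz
... | true  = x , eq

-- Edge sums, vertex sums, and edges at a vertex

module _ {n} (G : Graph n) where
  open Graph G

  private
    before : Fin n → Fin n → Bool
    before u v = (Fin.toℕ u ℕ.<ᵇ Fin.toℕ v) ∧ adjacent u v

  -- An edge is listed in exactly one of its two orientations, so one bracket is `adjacent u v` and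
  -- the other is false. For u = v both sides vanish because there are no loops.
  orientations : ∀ u v q → [ before u v ] q ℚ.+ [ before v u ] q ≡ [ adjacent u v ] q
  orientations u v q rewrite symmetric v u with ℕ.<-cmp (Fin.toℕ u) (Fin.toℕ v)
  ... | tri< u<v _ v≮u rewrite <⇒<ᵇ-true u<v | ≮⇒<ᵇ-false v≮u = ℚ.+-identityʳ _
  ... | tri> u≮v _ v<u rewrite <⇒<ᵇ-true v<u | ≮⇒<ᵇ-false u≮v = ℚ.+-identityˡ _
  ... | tri≈ u≮v u≡v v≮u rewrite ≮⇒<ᵇ-false u≮v | ≮⇒<ᵇ-false v≮u | Fin.toℕ-injective u≡v | loopless v = refl

  -- The weighted handshake lemma. Interchanging the two summations in the `head` part makes both
  -- parts carry `f u` for the outer vertex u; the two orientations then merge into the full list of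
  -- neighbours of u, whose length is the degree.
  handshake : ∀ (f : Fin n → ℚ) →
              sumℚ (edges G) (λ (u , v) → f u ℚ.+ f v) ≡ sumℚ (allFin n) (λ u → fromℕ (degree G u) ℚ.* f u)
  handshake f = begin
    sumℚ (edges G) (λ (u , v) → f u ℚ.+ f v)
      ≡⟨ sumℚ-filterᵇ (λ (u , v) → before u v) (cartesianProduct V V) (λ (u , v) → f u ℚ.+ f v) ⟩
    sumℚ (cartesianProduct V V) (λ (u , v) → [ before u v ] (f u ℚ.+ f v))
      ≡⟨ sumℚ-cartesianProduct V V (λ (u , v) → [ before u v ] (f u ℚ.+ f v)) ⟩
    double (λ u v → [ before u v ] (f u ℚ.+ f v))
      ≡⟨ double-cong (λ u v → []-distrib-+ (before u v) (f u) (f v)) ⟩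
    double (λ u v → tail u v ℚ.+ head u v)
      ≡⟨ double-+ tail head ⟩
    double tail ℚ.+ double head
      ≡⟨ cong (double tail ℚ.+_) (sumℚ-swap V V head) ⟩
    double tail ℚ.+ double (λ u v → head v u)
      ≡⟨ sym (double-+ tail (λ u v → head v u)) ⟩
    double (λ u v → tail u v ℚ.+ head v u)
      ≡⟨ double-cong (λ u v → orientations u v (f u)) ⟩
    double (λ u v → [ adjacent u v ] f u)
      ≡⟨ sumℚ-cong V (λ u → trans (sym (sumℚ-filterᵇ (adjacent u) V (λ _ → f u))) (sumℚ-const (filterᵇ (adjacent u) V) (f u))) ⟩
    sumℚ V (λ u → fromℕ (degree G u) ℚ.* f u) ∎
    where
    open ≡-Reasoning
    V = allFin n

    double : (Fin n → Fin n → ℚ) → ℚ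
    double g = sumℚ V (λ u → sumℚ V (g u))

    double-cong : ∀ {g h} → (∀ u v → g u v ≡ h u v) → double g ≡ double h
    double-cong g≗h = sumℚ-cong V (λ u → sumℚ-cong V (g≗h u))

    double-+ : ∀ g h → double (λ u v → g u v ℚ.+ h u v) ≡ double g ℚ.+ double h
    double-+ g h = trans (sumℚ-cong V (λ u → sumℚ-+ V (g u) (h u))) (sumℚ-+ V (λ u → sumℚ V (g u)) (λ u → sumℚ V (h u)))

    tail head : Fin n → Fin n → ℚ
    tail u v = [ before u v ] f u
    head u v = [ before u v ] f v

  private
    edge : ∀ u v → Fin.toℕ u ℕ.< Fin.toℕ v → adjacent u v ≡ true → (u , v) ∈ edges G
    edge u v u<v adj = ∈-filter⁺ (T? ∘ (λ (u , v) → before u v)) (∈-cartesianProduct⁺ (∈-allFin u) (∈-allFin v))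
      (Equivalence.from T-∧ (ℕ.<⇒<ᵇ u<v , Equivalence.from T-≡ adj))

  incident-edge : ∀ u → NonZero (degree G u) → ∃[ v ] ((u , v) ∈ edges G ⊎ (v , u) ∈ edges G)
  incident-edge u nz with filterᵇ-witness (adjacent u) (allFin n) nz
  ... | v , adj with ℕ.<-cmp (Fin.toℕ u) (Fin.toℕ v)
  ...   | tri< u<v _ _ = v , inj₁ (edge u v u<v adj)
  ...   | tri> _ _ v<u = v , inj₂ (edge v u v<u (trans (symmetric v u) adj))
  ...   | tri≈ _ u≡v _ with refl ← Fin.toℕ-injective u≡v with () ← trans (sym adj) (loopless u)

  edges-constant⇒regular : {{NoIsolatedVertex G}} → ∀ c →
    (∀ {u v} → (u , v) ∈ edges G → degree G u ≡ c × degree G v ≡ c) → Regular G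
  edges-constant⇒regular {{ni}} c h u v = trans (at u) (sym (at v))
    where
    at : ∀ w → degree G w ≡ c
    at w with incident-edge w (NoIsolatedVertex.degree≢0 ni w)
    ... | _ , inj₁ e = proj₁ (h e)
    ... | _ , inj₂ e = proj₂ (h e)

-- Sums of reals

seq-sum : ∀ (xs : List A) f n → seq (sum xs f) n ≡ sumℚ xs (λ x → seq (f x) n)
seq-sum []       f n = refl
seq-sum (x ∷ xs) f n = cong (λ s → seq (f x) n ℚ.+ s) (seq-sum xs f n)

sum-∷ : ∀ (x : A) xs f → sum (x ∷ xs) f ≈ f x + sum xs f
sum-∷ x xs f = pointwise-≈ {sum (x ∷ xs) f} {f x + sum xs f} λ _ → refl

-- Stated for an arbitrary step c so that unification can find the summand of SDD, which mentions
-- private names of Defs.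
foldr-≈-sum : ∀ {c : A → ℝ → ℝ} xs f → (∀ x s n → seq (c x s) n ≡ seq (f x) n ℚ.+ seq s n) →
              foldr c 0ℝ xs ≈ sum xs f
foldr-≈-sum {c = c} xs f h = pointwise-≈ {foldr c 0ℝ xs} {sum xs f} λ n → go n xs
  where
  go : ∀ n xs → seq (foldr c 0ℝ xs) n ≡ seq (sum xs f) n
  go n []       = refl
  go n (x ∷ xs) = trans (h x (foldr c 0ℝ xs) n) (cong (λ s → seq (f x) n ℚ.+ s) (go n xs))

sum-mono-≤ : ∀ (xs : List A) f g → (∀ x → f x ≤ g x) → sum xs f ≤ sum xs g
sum-mono-≤ []       f g f≤g = eventually-≤ 0 λ _ _ → ℚ.≤-refl
sum-mono-≤ (x ∷ xs) f g f≤g = ≤-trans (≈⇒≤ (sum-∷ x xs f)) (≤-trans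
  (+-mono-≤ {f x} {g x} {sum xs f} {sum xs g} (f≤g x) (sum-mono-≤ xs f g f≤g))
  (≈⇒≤ (≈-sym (sum-∷ x xs g))))

sum-cong : ∀ (xs : List A) f g → (∀ x → f x ≈ g x) → sum xs f ≈ sum xs g
sum-cong xs f g f≈g = ≤-antisym (sum-mono-≤ xs f g (≈⇒≤ ∘ f≈g)) (sum-mono-≤ xs g f (≈⇒≤ ∘ ≈-sym ∘ f≈g))

infixr 7 _⊛_

_⊛_ : ℝ → (A → ℝ) → A → ℝ
(c ⊛ f) x = c * f x

*-sum : ∀ {s} (xs : List A) c f → s ≈ sum xs f → c * s ≈ sum xs (c ⊛ f)
*-sum {s = s} xs c f s≈ = ≈-trans (*-congˡ {s} {sum xs f} c s≈)
  (pointwise-≈ {c * sum xs f} {sum xs (c ⊛ f)} λ n → trans (cong (seq c n ℚ.*_) (seq-sum xs f n))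
    (trans (sumℚ-*ˡ xs (seq c n) (λ x → seq (f x) n)) (sym (seq-sum xs (c ⊛ f) n))))

-- At each cons the equality of totals splits into equality of the heads, by `+-squeezeʳ`, and of
-- the tails, by `+-squeezeˡ`.
sum-squeeze : ∀ (xs : List A) f g → (∀ x → f x ≤ g x) → sum xs f ≈ sum xs g → ∀ {x} → x ∈ xs → f x ≈ g x
sum-squeeze (y ∷ xs) f g f≤g eq x∈ = member x∈
  where
  tail≤ = sum-mono-≤ xs f g f≤g

  split : f y + sum xs f ≈ g y + sum xs g
  split = ≈-trans (≈-sym (sum-∷ y xs f)) (≈-trans eq (sum-∷ y xs g))

  member : ∀ {x} → x ∈ y ∷ xs → f x ≈ g x
  member (here refl) = +-squeezeʳ {f y} {g y} {sum xs f} {sum xs g} (f≤g y) tail≤ split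
  member (there x∈)  = sum-squeeze xs f g f≤g (+-squeezeˡ {f y} {g y} {sum xs f} {sum xs g} (f≤g y) tail≤ split) x∈

-- Here q = 1/(x y), so x/y = x² q and y/x = y² q.
quotient : ∀ {x y z q} → z * y ≈ x → q * (x * y) ≈ 1ℝ → z ≈ x * x * q
quotient {x} {y} {z} {q} zy≈x inv = begin-equality
  z                     ≈⟨ pointwise-≈ (λ n → sym (ℚ.*-identityʳ (seq z n))) ⟩
  z * 1ℝ                ≈⟨ *-congˡ {1ℝ} {q * (x * y)} z (≈-sym inv) ⟩
  z * (q * (x * y))     ≈⟨ pointwise-≈ (λ n → solve 4 (λ x y z q → z :* (q :* (x :* y)) := (z :* y) :* (x :* q)) refl
                             (seq x n) (seq y n) (seq z n) (seq q n)) ⟩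
  (z * y) * (x * q)     ≈⟨ *-congʳ {z * y} {x} (x * q) zy≈x ⟩
  x * (x * q)           ≈⟨ ≈-sym (*-assoc x x q) ⟩
  x * x * q             ∎
  where open ≤-Reasoning

quotient-sum : ∀ {x y z w q} → z * y ≈ x → w * x ≈ y → q * (x * y) ≈ 1ℝ → z + w ≈ (x * x + y * y) * q
quotient-sum {x} {y} {z} {w} {q} zy≈x wx≈y inv = ≈-trans
  (+-cong {z} {x * x * q} {w} {y * y * q}
    (quotient {x} {y} {z} {q} zy≈x inv)
    (quotient {y} {x} {w} {q} wx≈y (≈-trans (*-congˡ {y * x} {x * y} q (*-comm y x)) inv)))
  (pointwise-≈ λ n → solve 3 (λ x y q → x :* x :* q :+ y :* y :* q := (x :* x :+ y :* y) :* q) refl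
    (seq x n) (seq y n) (seq q n))

^-double : ∀ d .{{_ : NonZero d}} α → d ^ (2ℝ * α) ≈ d ^ α * d ^ α
^-double d α = ≈-trans
  -- The rational 2 evaluates to `1ℚ + 1ℚ`, so distributivity applies to it directly.
  (^-congʳ d (2ℝ * α) (α + α) λ n → trans (ℚ.*-distribʳ-+ (seq α n) 1ℚ 1ℚ)
     (cong₂ ℚ._+_ (ℚ.*-identityˡ (seq α n)) (ℚ.*-identityˡ (seq α n))))
  (^-homo-+ d α α)

power-quotient-sum : ∀ a b .{{_ : NonZero a}} .{{_ : NonZero b}} .{{_ : NonZero (a ℕ.* b)}} α →
  (a ^ α / b ^ α) {{^-positive b α}} + (b ^ α / a ^ α) {{^-positive a α}} ≈ (a ^ (2ℝ * α) + b ^ (2ℝ * α)) * (a ℕ.* b) ^ (- α)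
power-quotient-sum a b α = ≈-trans
  (quotient-sum {a ^ α} {b ^ α} {(a ^ α / b ^ α) {{^-positive b α}}} {(b ^ α / a ^ α) {{^-positive a α}}} {(a ℕ.* b) ^ (- α)}
    (/-*-inverse (a ^ α) (b ^ α) {{^-positive b α}}) (/-*-inverse (b ^ α) (a ^ α) {{^-positive a α}})
    (≈-trans (*-congˡ {a ^ α * b ^ α} {(a ℕ.* b) ^ α} ((a ℕ.* b) ^ (- α)) (≈-sym (^-distribʳ-* a b α)))
             (^-inverse (a ℕ.* b) α)))
  (*-congʳ {a ^ α * a ^ α + b ^ α * b ^ α} {a ^ (2ℝ * α) + b ^ (2ℝ * α)} ((a ℕ.* b) ^ (- α))
    (+-cong {a ^ α * a ^ α} {a ^ (2ℝ * α)} {b ^ α * b ^ α} {b ^ (2ℝ * α)} (≈-sym (^-double a α)) (≈-sym (^-double b α))))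

double-positive : ∀ {α} → 0ℝ < α → 0ℝ < 2ℝ * α
double-positive {α} 0<α = mk< (gap 0<α) (gap>0 0<α) (from 0<α) λ n N≤n → ℚ.≤-trans (separated 0<α n N≤n)
  (ℚ.≤-trans (ℚ.≤-trans (ℚ.≤-reflexive (sym (ℚ.+-identityˡ (seq α n))))
      (ℚ.+-monoˡ-≤ (seq α n) (ℚ.≤-trans (ℚ.<⇒≤ (gap>0 0<α)) (gap≤ 0<α n N≤n))))
    (ℚ.≤-reflexive (solve 1 (λ a → a :+ a := (con 1ℚ :+ con 1ℚ) :* a) refl (seq α n))))

2*≈+ : ∀ x → 2ℝ * x ≈ x + x
2*≈+ x = pointwise-≈ λ n → solve 1 (λ a → (con 1ℚ :+ con 1ℚ) :* a := a :+ a) refl (seq x n)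

-- Equality in a bound with M₁ determines only the product of the two degrees at an edge. The
-- one-sided bounds recover the factors: m c ≤ m n = c c gives m ≤ c, and likewise for n.
m*n≡c*c⇒≡ˡ : ∀ {c m n} .{{_ : NonZero c}} → c ℕ.≤ m → c ℕ.≤ n → m ℕ.* n ≡ c ℕ.* c → m ≡ c × n ≡ c
m*n≡c*c⇒≡ˡ {c} {m} {n} c≤m c≤n eq =
  ℕ.≤-antisym (ℕ.*-cancelʳ-≤ m c c (ℕ.≤-trans (ℕ.*-monoʳ-≤ m c≤n) (ℕ.≤-reflexive eq))) c≤m ,
  ℕ.≤-antisym (ℕ.*-cancelˡ-≤ c (ℕ.≤-trans (ℕ.*-monoˡ-≤ n c≤m) (ℕ.≤-reflexive eq))) c≤n

m*n≡c*c⇒≡ʳ : ∀ {c m n} .{{_ : NonZero c}} → m ℕ.≤ c → n ℕ.≤ c → m ℕ.* n ≡ c ℕ.* c → m ≡ c × n ≡ c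
m*n≡c*c⇒≡ʳ {c} {m} {n} m≤c n≤c eq =
  ℕ.≤-antisym m≤c (ℕ.*-cancelʳ-≤ c m c (ℕ.≤-trans (ℕ.≤-reflexive (sym eq)) (ℕ.*-monoʳ-≤ m n≤c))) ,
  ℕ.≤-antisym n≤c (ℕ.*-cancelˡ-≤ c (ℕ.≤-trans (ℕ.≤-reflexive (sym eq)) (ℕ.*-monoˡ-≤ n m≤c)))

-- The four bounds, edge by edge

module _ {n} (G : Graph n) {{noIsolated : NoIsolatedVertex G}} (α : ℝ) (0<α : 0ℝ < α) where
  private
    instance
      degree-nonZero : ∀ {v} → NonZero (degree G v)
      degree-nonZero {v} = NoIsolatedVertex.degree≢0 noIsolated v

      product-nonZero : ∀ {u v} → NonZero (degree G u ℕ.* degree G v)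
      product-nonZero {u} {v} = ℕ.m*n≢0 (degree G u) (degree G v)

    0<2α : 0ℝ < 2ℝ * α
    0<2α = double-positive {α} 0<α

    d : Fin n → ℕ
    d = degree G

    P Q S : Fin n × Fin n → ℝ
    P (u , v) = d u ^ (2ℝ * α) + d v ^ (2ℝ * α)
    Q (u , v) = (d u ℕ.* d v) ^ (- α)
    S (u , v) = (d u ^ α / d v ^ α) {{^-positive (d v) α}} + (d v ^ α / d u ^ α) {{^-positive (d u) α}}

    P-positive : ∀ e → 0ℝ < P e
    P-positive (u , v) = +-positive {d u ^ (2ℝ * α)} {d v ^ (2ℝ * α)} (^-positive (d u) (2ℝ * α)) (^-positive (d v) (2ℝ * α))

    Q-positive : ∀ e → 0ℝ < Q e
    Q-positive (u , v) = ^-positive (d u ℕ.* d v) (- α)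

    S≈P*Q : ∀ e → S e ≈ P e * Q e
    S≈P*Q (u , v) = ≈-trans
      (pointwise-≈ {S (u , v)} {(d u ^ α / d v ^ α) {{^-positive (d v) α}} + (d v ^ α / d u ^ α) {{^-positive (d u) α}}} λ _ → refl)
      (≈-trans (power-quotient-sum (d u) (d v) α)
      (*-cong {d u ^ (2ℝ * α) + d v ^ (2ℝ * α)} {P (u , v)} {(d u ℕ.* d v) ^ (- α)} {Q (u , v)}
        (pointwise-≈ {d u ^ (2ℝ * α) + d v ^ (2ℝ * α)} {P (u , v)} λ _ → refl)
        (pointwise-≈ {(d u ℕ.* d v) ^ (- α)} {Q (u , v)} λ _ → refl)))

    SDD-sum : SDD G α ≈ sum (edges G) S
    SDD-sum = foldr-≈-sum (edges G) S λ _ _ _ → refl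

    M₂-sum : M₂ G (- α) ≈ sum (edges G) Q
    M₂-sum = foldr-≈-sum (edges G) Q λ _ _ _ → refl

    -- The extra 1 in the exponent supplies a factor `d u`, which is exactly the weight of u in
    -- `handshake`; that identity is applied at each index k to the terms of `d u ^ (2ℝ * α)`.
    M₁-sum : M₁ G (2ℝ * α + 1ℝ) ≈ sum (edges G) P
    M₁-sum = ≈-trans as-sum (≈-trans (sum-cong (allFin n) raw weighted power) regroup)
      where
      open ≤-Reasoning
      weighted : Fin n → ℝ
      weighted u = fromℚ (fromℕ (d u)) * d u ^ (2ℝ * α)

      raw : Fin n → ℝ
      raw u = d u ^ (2ℝ * α + 1ℝ)

      power : ∀ u → raw u ≈ weighted u
      power u = begin-equality
        d u ^ (2ℝ * α + 1ℝ)                       ≈⟨ ^-homo-+ (d u) (2ℝ * α) 1ℝ ⟩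
        d u ^ (2ℝ * α) * d u ^ 1ℝ                 ≈⟨ *-congˡ {d u ^ 1ℝ} {fromℚ (fromℕ (d u))} (d u ^ (2ℝ * α)) (^-identityʳ (d u)) ⟩
        d u ^ (2ℝ * α) * fromℚ (fromℕ (d u))      ≈⟨ *-comm (d u ^ (2ℝ * α)) (fromℚ (fromℕ (d u))) ⟩
        weighted u                                ∎

      as-sum : M₁ G (2ℝ * α + 1ℝ) ≈ sum (allFin n) raw
      as-sum = foldr-≈-sum (allFin n) raw λ _ _ _ → refl

      regroup : sum (allFin n) weighted ≈ sum (edges G) P
      regroup = pointwise-≈ {sum (allFin n) weighted} {sum (edges G) P} λ k →
        trans (seq-sum (allFin n) weighted k)
          (trans (sym (handshake G (λ u → seq (d u ^ (2ℝ * α)) k))) (sym (seq-sum (edges G) P k)))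

    PQ : Fin n × Fin n → ℝ
    PQ e = P e * Q e

    SDD≈ : SDD G α ≈ sum (edges G) PQ
    SDD≈ = ≈-trans SDD-sum (sum-cong (edges G) S PQ S≈P*Q)

    -- The two lower bounds differ only in the edge term `F` and in how equality at one edge fixes
    -- the degrees there (`tight`); the summation and the squeeze are shared.
    lower-bound : ∀ c X (F : Fin n × Fin n → ℝ) → X ≈ sum (edges G) F → (∀ e → F e ≤ P e * Q e) →
                  (∀ u v → F (u , v) ≈ P (u , v) * Q (u , v) → d u ≡ c × d v ≡ c) →
                  X ≤ SDD G α × (SDD G α ≈ X → Regular G)
    lower-bound c X F X≈ F≤ tight =
      ≤-trans (≈⇒≤ X≈) (≤-trans (sum-mono-≤ (edges G) F PQ F≤) (≈⇒≤ (≈-sym SDD≈))) ,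
      λ eq → edges-constant⇒regular G c λ {u} {v} e∈ → tight u v
        (sum-squeeze (edges G) F PQ F≤ (≈-trans (≈-sym X≈) (≈-trans (≈-sym eq) SDD≈)) e∈)

    upper-bound : ∀ c X (F : Fin n × Fin n → ℝ) → X ≈ sum (edges G) F → (∀ e → P e * Q e ≤ F e) →
                  (∀ u v → P (u , v) * Q (u , v) ≈ F (u , v) → d u ≡ c × d v ≡ c) →
                  SDD G α ≤ X × (SDD G α ≈ X → Regular G)
    upper-bound c X F X≈ ≤F tight =
      ≤-trans (≈⇒≤ SDD≈) (≤-trans (sum-mono-≤ (edges G) PQ F ≤F) (≈⇒≤ (≈-sym X≈))) ,
      λ eq → edges-constant⇒regular G c λ {u} {v} e∈ → tight u v
        (sum-squeeze (edges G) PQ F ≤F (≈-trans (≈-sym SDD≈) (≈-trans eq X≈)) e∈)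

    -- Puts the constants δ^(-2α) and Δ^(-2α) in the form of `Q`, a product of two naturals under
    -- the exponent -α, so that only the products of naturals remain to be compared.
    ^-neg-double : ∀ c .{{_ : NonZero c}} .{{_ : NonZero (c ℕ.* c)}} → c ^ (- (2ℝ * α)) ≈ (c ℕ.* c) ^ (- α)
    ^-neg-double c = ≈-trans
      (^-congʳ c (- (2ℝ * α)) (- α + - α) λ k →
        solve 1 (λ a → :- ((con 1ℚ :+ con 1ℚ) :* a) := (:- a) :+ (:- a)) refl (seq α k))
      (≈-trans (^-homo-+ c (- α) (- α)) (≈-sym (^-distribʳ-* c c (- α))))

    0≤α : EventuallyNonNegative α
    0≤α = positive⇒nonNegative {α} 0<α

    0≤2α : EventuallyNonNegative (2ℝ * α)
    0≤2α = positive⇒nonNegative {2ℝ * α} 0<2α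

  module _ (δ : ℕ) .{{_ : NonZero δ}} (δ≤ : ∀ v → δ ℕ.≤ degree G v) where
    private
      power≤ : ∀ v → δ ^ (2ℝ * α) ≤ d v ^ (2ℝ * α)
      power≤ v = ^-monoˡ-≤ (2ℝ * α) 0≤2α (δ≤ v)

      instance
        δ*δ-nonZero : NonZero (δ ℕ.* δ)
        δ*δ-nonZero = ℕ.m*n≢0 δ δ

    minimum-M₂-bound : (2ℝ * δ ^ (2ℝ * α) * M₂ G {{noIsolated}} (- α) ≤ SDD G α) ×
                       (SDD G α ≈ 2ℝ * δ ^ (2ℝ * α) * M₂ G {{noIsolated}} (- α) → Regular G)
    minimum-M₂-bound = lower-bound δ (2ℝ * δ ^ (2ℝ * α) * M₂ G {{noIsolated}} (- α)) ((2ℝ * δ ^ (2ℝ * α)) ⊛ Q)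
      (*-sum {s = M₂ G {{noIsolated}} (- α)} (edges G) (2ℝ * δ ^ (2ℝ * α)) Q M₂-sum) termwise tight
      where
      2*≤P : ∀ e → 2ℝ * δ ^ (2ℝ * α) ≤ P e
      2*≤P (u , v) = ≤-trans (≈⇒≤ (2*≈+ (δ ^ (2ℝ * α))))
        (+-mono-≤ {δ ^ (2ℝ * α)} {d u ^ (2ℝ * α)} {δ ^ (2ℝ * α)} {d v ^ (2ℝ * α)} (power≤ u) (power≤ v))

      termwise : ∀ e → ((2ℝ * δ ^ (2ℝ * α)) ⊛ Q) e ≤ P e * Q e
      termwise e = *-monoʳ-≤ {2ℝ * δ ^ (2ℝ * α)} {P e} (Q e) (Q-positive e) (2*≤P e)

      tight : ∀ u v → ((2ℝ * δ ^ (2ℝ * α)) ⊛ Q) (u , v) ≈ P (u , v) * Q (u , v) → d u ≡ δ × d v ≡ δ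
      tight u v eq =
        sym (^-injectiveˡ (2ℝ * α) 0<2α
          (+-squeezeʳ {δ ^ (2ℝ * α)} {d u ^ (2ℝ * α)} {δ ^ (2ℝ * α)} {d v ^ (2ℝ * α)} (power≤ u) (power≤ v) endpoints)) ,
        sym (^-injectiveˡ (2ℝ * α) 0<2α
          (+-squeezeˡ {δ ^ (2ℝ * α)} {d u ^ (2ℝ * α)} {δ ^ (2ℝ * α)} {d v ^ (2ℝ * α)} (power≤ u) (power≤ v) endpoints))
        where
        endpoints : δ ^ (2ℝ * α) + δ ^ (2ℝ * α) ≈ d u ^ (2ℝ * α) + d v ^ (2ℝ * α)
        -- Cancelling the positive factor `Q` leaves an equality between sums of two powers, in
        -- which each endpoint is then squeezed separately.
        endpoints = ≈-trans (≈-sym (2*≈+ (δ ^ (2ℝ * α))))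
          (*-cancelʳ {2ℝ * δ ^ (2ℝ * α)} {P (u , v)} (Q (u , v)) (Q-positive (u , v)) eq)

    minimum-M₁-bound : (SDD G α ≤ δ ^ (- (2ℝ * α)) * M₁ G {{noIsolated}} (2ℝ * α + 1ℝ)) ×
                       (SDD G α ≈ δ ^ (- (2ℝ * α)) * M₁ G {{noIsolated}} (2ℝ * α + 1ℝ) → Regular G)
    minimum-M₁-bound = upper-bound δ (δ ^ (- (2ℝ * α)) * M₁ G {{noIsolated}} (2ℝ * α + 1ℝ)) (δ ^ (- (2ℝ * α)) ⊛ P)
      (*-sum {s = M₁ G {{noIsolated}} (2ℝ * α + 1ℝ)} (edges G) (δ ^ (- (2ℝ * α))) P M₁-sum) termwise tight
      where
      Q≤ : ∀ e → Q e ≤ δ ^ (- (2ℝ * α))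
      Q≤ (u , v) = ≤-trans (^-antimonoˡ-≤ α 0≤α (ℕ.*-mono-≤ (δ≤ u) (δ≤ v))) (≈⇒≤ (≈-sym (^-neg-double δ)))

      termwise : ∀ e → P e * Q e ≤ (δ ^ (- (2ℝ * α)) ⊛ P) e
      termwise e = ≤-trans (*-monoˡ-≤ {Q e} {δ ^ (- (2ℝ * α))} (P e) (P-positive e) (Q≤ e))
        (≈⇒≤ (*-comm (P e) (δ ^ (- (2ℝ * α)))))

      tight : ∀ u v → P (u , v) * Q (u , v) ≈ (δ ^ (- (2ℝ * α)) ⊛ P) (u , v) → d u ≡ δ × d v ≡ δ
      -- Here `P` cancels, leaving an equality of powers with exponent -α; injectivity yields d u ·
      -- d v = δ · δ, and neither factor is below δ.
      tight u v eq = m*n≡c*c⇒≡ˡ (δ≤ u) (δ≤ v) (^-neg-injectiveˡ α 0<α (≈-trans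
        (*-cancelʳ {Q (u , v)} {δ ^ (- (2ℝ * α))} (P (u , v)) (P-positive (u , v)) (≈-trans (*-comm (Q (u , v)) (P (u , v))) eq))
        (^-neg-double δ)))

  module _ (Δ : ℕ) .{{_ : NonZero Δ}} (≤Δ : ∀ v → degree G v ℕ.≤ Δ) where
    private
      power≤ : ∀ v → d v ^ (2ℝ * α) ≤ Δ ^ (2ℝ * α)
      power≤ v = ^-monoˡ-≤ (2ℝ * α) 0≤2α (≤Δ v)

      instance
        Δ*Δ-nonZero : NonZero (Δ ℕ.* Δ)
        Δ*Δ-nonZero = ℕ.m*n≢0 Δ Δ

    maximum-M₂-bound : (SDD G α ≤ 2ℝ * Δ ^ (2ℝ * α) * M₂ G {{noIsolated}} (- α)) ×
                       (SDD G α ≈ 2ℝ * Δ ^ (2ℝ * α) * M₂ G {{noIsolated}} (- α) → Regular G)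
    maximum-M₂-bound = upper-bound Δ (2ℝ * Δ ^ (2ℝ * α) * M₂ G {{noIsolated}} (- α)) ((2ℝ * Δ ^ (2ℝ * α)) ⊛ Q)
      (*-sum {s = M₂ G {{noIsolated}} (- α)} (edges G) (2ℝ * Δ ^ (2ℝ * α)) Q M₂-sum) termwise tight
      where
      P≤2* : ∀ e → P e ≤ 2ℝ * Δ ^ (2ℝ * α)
      P≤2* (u , v) = ≤-trans
        (+-mono-≤ {d u ^ (2ℝ * α)} {Δ ^ (2ℝ * α)} {d v ^ (2ℝ * α)} {Δ ^ (2ℝ * α)} (power≤ u) (power≤ v))
        (≈⇒≤ (≈-sym (2*≈+ (Δ ^ (2ℝ * α)))))

      termwise : ∀ e → P e * Q e ≤ ((2ℝ * Δ ^ (2ℝ * α)) ⊛ Q) e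
      termwise e = *-monoʳ-≤ {P e} {2ℝ * Δ ^ (2ℝ * α)} (Q e) (Q-positive e) (P≤2* e)

      tight : ∀ u v → P (u , v) * Q (u , v) ≈ ((2ℝ * Δ ^ (2ℝ * α)) ⊛ Q) (u , v) → d u ≡ Δ × d v ≡ Δ
      tight u v eq =
        ^-injectiveˡ (2ℝ * α) 0<2α
          (+-squeezeʳ {d u ^ (2ℝ * α)} {Δ ^ (2ℝ * α)} {d v ^ (2ℝ * α)} {Δ ^ (2ℝ * α)} (power≤ u) (power≤ v) endpoints) ,
        ^-injectiveˡ (2ℝ * α) 0<2α
          (+-squeezeˡ {d u ^ (2ℝ * α)} {Δ ^ (2ℝ * α)} {d v ^ (2ℝ * α)} {Δ ^ (2ℝ * α)} (power≤ u) (power≤ v) endpoints)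
        where
        endpoints : d u ^ (2ℝ * α) + d v ^ (2ℝ * α) ≈ Δ ^ (2ℝ * α) + Δ ^ (2ℝ * α)
        endpoints = ≈-trans
          (*-cancelʳ {P (u , v)} {2ℝ * Δ ^ (2ℝ * α)} (Q (u , v)) (Q-positive (u , v)) eq) (2*≈+ (Δ ^ (2ℝ * α)))

    maximum-M₁-bound : (Δ ^ (- (2ℝ * α)) * M₁ G {{noIsolated}} (2ℝ * α + 1ℝ) ≤ SDD G α) ×
                       (SDD G α ≈ Δ ^ (- (2ℝ * α)) * M₁ G {{noIsolated}} (2ℝ * α + 1ℝ) → Regular G)
    maximum-M₁-bound = lower-bound Δ (Δ ^ (- (2ℝ * α)) * M₁ G {{noIsolated}} (2ℝ * α + 1ℝ)) (Δ ^ (- (2ℝ * α)) ⊛ P)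
      (*-sum {s = M₁ G {{noIsolated}} (2ℝ * α + 1ℝ)} (edges G) (Δ ^ (- (2ℝ * α))) P M₁-sum) termwise tight
      where
      ≤Q : ∀ e → Δ ^ (- (2ℝ * α)) ≤ Q e
      ≤Q (u , v) = ≤-trans (≈⇒≤ (^-neg-double Δ)) (^-antimonoˡ-≤ α 0≤α (ℕ.*-mono-≤ (≤Δ u) (≤Δ v)))

      termwise : ∀ e → (Δ ^ (- (2ℝ * α)) ⊛ P) e ≤ P e * Q e
      termwise e = ≤-trans (≈⇒≤ (*-comm (Δ ^ (- (2ℝ * α))) (P e)))
        (*-monoˡ-≤ {Δ ^ (- (2ℝ * α))} {Q e} (P e) (P-positive e) (≤Q e))

      tight : ∀ u v → (Δ ^ (- (2ℝ * α)) ⊛ P) (u , v) ≈ P (u , v) * Q (u , v) → d u ≡ Δ × d v ≡ Δ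
      tight u v eq = m*n≡c*c⇒≡ʳ (≤Δ u) (≤Δ v) (^-neg-injectiveˡ α 0<α (≈-sym (≈-trans (≈-sym (^-neg-double Δ))
        (*-cancelʳ {Δ ^ (- (2ℝ * α))} {Q (u , v)} (P (u , v)) (P-positive (u , v))
          (≈-trans eq (*-comm (P (u , v)) (Q (u , v))))))))

theorem2 : ∀ {n} (G : Graph n) {{_ : NoIsolatedVertex G}}
    (δ Δ : ℕ) .{{_ : NonZero δ}} .{{_ : NonZero Δ}} →
    IsMinimumDegree G δ → IsMaximumDegree G Δ →
    (α : ℝ) → 0ℝ < α →
    (2ℝ * δ ^ (2ℝ * α) * M₂ G (- α) ≤ SDD G α) ×
    (SDD G α ≤ 2ℝ * Δ ^ (2ℝ * α) * M₂ G (- α)) ×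
    (Δ ^ (- (2ℝ * α)) * M₁ G (2ℝ * α + 1ℝ) ≤ SDD G α) ×
    (SDD G α ≤ δ ^ (- (2ℝ * α)) * M₁ G (2ℝ * α + 1ℝ)) ×
    (SDD G α ≈ 2ℝ * δ ^ (2ℝ * α) * M₂ G (- α) ⇔ Regular G) ×
    (SDD G α ≈ 2ℝ * Δ ^ (2ℝ * α) * M₂ G (- α) ⇔ Regular G) ×
    (SDD G α ≈ Δ ^ (- (2ℝ * α)) * M₁ G (2ℝ * α + 1ℝ) ⇔ Regular G) ×
    (SDD G α ≈ δ ^ (- (2ℝ * α)) * M₁ G (2ℝ * α + 1ℝ) ⇔ Regular G)
theorem2 G {{noIsolated}} δ Δ ((v , refl-δ) , δ≤) ((w , refl-Δ) , ≤Δ) α 0<α =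
  proj₁ δM₂ , proj₁ ΔM₂ , proj₁ ΔM₁ , proj₁ δM₁ ,
  -- For the converse no sum over a regular graph is evaluated: regularity forces δ = Δ, so the
  -- lower and upper bounds with the same Zagreb index coincide and enclose `SDD G α`.
  mk⇔ (proj₂ δM₂) (λ r → ≤-antisym (≤-trans (proj₁ ΔM₂) (≈⇒≤ (≈-sym (M₂-≈ (δ≡Δ r))))) (proj₁ δM₂)) ,
  mk⇔ (proj₂ ΔM₂) (λ r → ≤-antisym (proj₁ ΔM₂) (≤-trans (≈⇒≤ (≈-sym (M₂-≈ (δ≡Δ r)))) (proj₁ δM₂))) ,
  mk⇔ (proj₂ ΔM₁) (λ r → ≤-antisym (≤-trans (proj₁ δM₁) (≈⇒≤ (M₁-≈ (δ≡Δ r)))) (proj₁ ΔM₁)) ,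
  mk⇔ (proj₂ δM₁) (λ r → ≤-antisym (proj₁ δM₁) (≤-trans (≈⇒≤ (M₁-≈ (δ≡Δ r))) (proj₁ ΔM₁)))
  where
  δM₂ = minimum-M₂-bound G α 0<α δ δ≤
  ΔM₂ = maximum-M₂-bound G α 0<α Δ ≤Δ
  ΔM₁ = maximum-M₁-bound G α 0<α Δ ≤Δ
  δM₁ = minimum-M₁-bound G α 0<α δ δ≤

  δ≡Δ : Regular G → δ ≡ Δ
  δ≡Δ r = trans (sym refl-δ) (trans (r v w) refl-Δ)

  M₂-≈ : δ ≡ Δ → 2ℝ * δ ^ (2ℝ * α) * M₂ G {{noIsolated}} (- α) ≈ 2ℝ * Δ ^ (2ℝ * α) * M₂ G {{noIsolated}} (- α)
  M₂-≈ eq = *-congʳ {2ℝ * δ ^ (2ℝ * α)} {2ℝ * Δ ^ (2ℝ * α)} (M₂ G {{noIsolated}} (- α))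
    (*-congˡ {δ ^ (2ℝ * α)} {Δ ^ (2ℝ * α)} 2ℝ (^-congˡ (2ℝ * α) eq))

  M₁-≈ : δ ≡ Δ → δ ^ (- (2ℝ * α)) * M₁ G {{noIsolated}} (2ℝ * α + 1ℝ) ≈ Δ ^ (- (2ℝ * α)) * M₁ G {{noIsolated}} (2ℝ * α + 1ℝ)
  M₁-≈ eq = *-congʳ {δ ^ (- (2ℝ * α))} {Δ ^ (- (2ℝ * α))} (M₁ G {{noIsolated}} (2ℝ * α + 1ℝ)) (^-congˡ (- (2ℝ * α)) eq)
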